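{- Let $V$ be a real vector space and $X\subseteq V$. The following are equivalent: (i) $X$ is contained in a finite union of lines; (ii) $X$ contains no infinite convexly independent subset; (iii) the order-dimension of $Co(V,X)$ is finite.
   Context: A subset $Y\subseteq V$ is convexly independent if $y\notin\mathrm{conv}(Y\setminus\{y\})$ for every $y\in Y$, where $\mathrm{conv}$ denotes the convex hull. $Co(V,X)$ is the family of sets $C\cap X$, $C$ convex in $V$, ordered by inclusion. The order-dimension of a poset $P$ is the least cardinal $\lambda$ such that $P$ embeds (as a poset) into a direct product of $\lambda$ chains, equivalently the order of $P$ is the intersection of $\lambda$ linear orders.
   Formalization: The formal theorem assumes that V is not the zero space: for V = {0} and X = {0} there are no lines, so (i) fails although (ii) and (iii) hold. -}

module Defs where

open import Level using (Level; suc; _⊔_)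
open import Algebra.Bundles using (CommutativeRing)
open import Algebra.Module.Bundles using (Module)
import Algebra.Properties.Monoid.Sum as Sum
open import Data.Fin.Base using (Fin)
open import Data.List.Base using (List)
open import Data.List.Relation.Unary.Any using (Any)
open import Data.Nat.Base as ℕ using (ℕ)
open import Data.Product.Base using (Σ; Σ-syntax; ∃; ∃-syntax; _×_; _,_)
open import Data.Vec.Functional using (Vector)
open import Relation.Binary.Bundles using (Poset; TotalOrder)
open import Relation.Binary.Core using (Rel)
open import Relation.Binary.Definitions using (_Respects_)
open import Relation.Binary.Morphism.Structures using (IsOrderMonomorphism)
open import Relation.Binary.Structures using (IsTotalOrder)
import Relation.Binary.Construct.On as On
open import Relation.Nullary.Negation.Core using (¬_)
open import Relation.Unary using (Pred; Satisfiable; _∈_; _⊆_; _∩_; _≐_)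
open import Relation.Unary.Relation.Binary.Subset using (⊆-poset)

-- The real numbers, axiomatised as a Dedekind-complete ordered field; classically
-- this determines them up to a unique isomorphism.
record RealField (ℓ : Level) : Set (suc ℓ) where
  field
    commutativeRing : CommutativeRing ℓ ℓ

  open CommutativeRing commutativeRing public

  infix 4 _≤_

  field
    _≤_          : Rel Carrier ℓ
    isTotalOrder : IsTotalOrder _≈_ _≤_
    0≉1          : ¬ (0# ≈ 1#)
    inverse      : ∀ x → ¬ (x ≈ 0#) → ∃[ y ] x * y ≈ 1#
    +-monoˡ-≤    : ∀ z {x y} → x ≤ y → x + z ≤ y + z
    *-nonNeg     : ∀ {x y} → 0# ≤ x → 0# ≤ y → 0# ≤ x * y

  UpperBound : Pred Carrier ℓ → Pred Carrier ℓ
  UpperBound P b = ∀ {x} → x ∈ P → x ≤ b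

  field
    supremum : (P : Pred Carrier ℓ) → Satisfiable P → Satisfiable (UpperBound P) →
               ∃[ s ] (s ∈ UpperBound P × (∀ {b} → b ∈ UpperBound P → s ≤ b))

RealVectorSpace : ∀ {ℓ} → RealField ℓ → Set (suc ℓ)
RealVectorSpace {ℓ} ℝ = Module (RealField.commutativeRing ℝ) ℓ ℓ

module _ {a ℓ₁ ℓ₂ : Level} where

  ∏ : ∀ {n} → (Fin n → TotalOrder a ℓ₁ ℓ₂) → Poset a ℓ₁ ℓ₂
  ∏ {n} C = record
    { Carrier = ∀ i → C.Carrier i
    ; _≈_ = λ x y → ∀ i → C._≈_ i (x i) (y i)
    ; _≤_ = λ x y → ∀ i → C._≤_ i (x i) (y i)
    ; isPartialOrder = record
      { isPreorder = record
        { isEquivalence = record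
          { refl  = λ i → C.Eq.refl i
          ; sym   = λ p i → C.Eq.sym i (p i)
          ; trans = λ p q i → C.Eq.trans i (p i) (q i)
          }
        ; reflexive = λ p i → C.reflexive i (p i)
        ; trans     = λ p q i → C.trans i (p i) (q i)
        }
      ; antisym = λ p q i → C.antisym i (p i) (q i)
      }
    }
    where module C (i : Fin n) = TotalOrder (C i)

  infix 4 _↪_

  _↪_ : Poset a ℓ₁ ℓ₂ → Poset a ℓ₁ ℓ₂ → Set _
  P ↪ Q = ∃ (IsOrderMonomorphism P._≈_ Q._≈_ P._≤_ Q._≤_)
    where
    module P = Poset P
    module Q = Poset Q

  -- The chains may be taken at the levels of P: classically, each can be replaced
  -- by the image of P in it, which is a linear preorder on the carrier of P.
  EmbedsInChains : Poset a ℓ₁ ℓ₂ → ℕ → Set _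
  EmbedsInChains P n = Σ[ C ∈ (Fin n → TotalOrder a ℓ₁ ℓ₂) ] (P ↪ ∏ C)

  record IsOrderDimension (P : Poset a ℓ₁ ℓ₂) (n : ℕ) : Set (suc (a ⊔ ℓ₁ ⊔ ℓ₂)) where
    field
      embeds : EmbedsInChains P n
      least  : ∀ {m} → EmbedsInChains P m → n ℕ.≤ m

  FiniteOrderDimension : Poset a ℓ₁ ℓ₂ → Set _
  FiniteOrderDimension P = ∃[ n ] IsOrderDimension P n

module Convexity {ℓ : Level} (ℝ : RealField ℓ) (V : RealVectorSpace ℝ) where

  open RealField ℝ
  open Module V
  open Sum +-monoid using (sum)
  open Sum +ᴹ-monoid using () renaming (sum to sumᴹ)

  -- In the zero space there are no lines, so a nonempty set there is not contained
  -- in a union of lines although it is finite.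
  Nontrivial : Set ℓ
  Nontrivial = ∃[ v ] ¬ (v ≈ᴹ 0ᴹ)

  -- Vectors are compared by _≈ᴹ_, so a set of vectors has to respect it.
  record Subset : Set (suc ℓ) where
    field
      mem  : Pred Carrierᴹ ℓ
      resp : mem Respects _≈ᴹ_

  open Subset public

  record Line : Set ℓ where
    field
      base        : Carrierᴹ
      direction   : Carrierᴹ
      direction≉0 : ¬ (direction ≈ᴹ 0ᴹ)

  points : Line → Pred Carrierᴹ ℓ
  points L x = ∃[ t ] x ≈ᴹ base +ᴹ t *ₗ direction
    where open Line L

  InFiniteUnionOfLines : Subset → Set ℓ
  InFiniteUnionOfLines X =
    ∃[ n ] Σ[ L ∈ (Fin n → Line) ] (∀ {x} → x ∈ mem X → ∃[ i ] x ∈ points (L i))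

  Finite : Subset → Set ℓ
  Finite Y = Σ[ ys ∈ List Carrierᴹ ] (∀ {y} → y ∈ mem Y → Any (y ≈ᴹ_) ys)

  Infinite : Subset → Set ℓ
  Infinite Y = ¬ Finite Y

  Convex : Subset → Set ℓ
  Convex C = ∀ {x y s t} → x ∈ mem C → y ∈ mem C → 0# ≤ s → 0# ≤ t → s + t ≈ 1# →
             s *ₗ x +ᴹ t *ₗ y ∈ mem C

  conv : Pred Carrierᴹ ℓ → Pred Carrierᴹ ℓ
  conv Y x = ∃[ n ] Σ[ t ∈ Vector Carrier n ] Σ[ p ∈ Vector Carrierᴹ n ]
    ((∀ i → 0# ≤ t i) × (∀ i → p i ∈ Y) × sum t ≈ 1# × x ≈ᴹ sumᴹ (λ i → t i *ₗ p i))

  infixl 7 _∖_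

  _∖_ : Pred Carrierᴹ ℓ → Carrierᴹ → Pred Carrierᴹ ℓ
  (Y ∖ y) z = z ∈ Y × ¬ (z ≈ᴹ y)

  ConvexlyIndependent : Subset → Set ℓ
  ConvexlyIndependent Y = ∀ {y} → y ∈ mem Y → ¬ (y ∈ conv (mem Y ∖ y))

  HasInfiniteConvexlyIndependentSubset : Subset → Set (suc ℓ)
  HasInfiniteConvexlyIndependentSubset X =
    ∃[ Y ] (mem Y ⊆ mem X × Infinite Y × ConvexlyIndependent Y)

  Trace : Subset → Set (suc ℓ)
  Trace X = Σ[ S ∈ Subset ] ∃[ C ] (Convex C × mem S ≐ mem C ∩ mem X)

  Co : Subset → Poset (suc ℓ) ℓ ℓ
  Co X = On.poset (⊆-poset Carrierᴹ ℓ) λ ((S , _) : Trace X) → mem S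

{-# OPTIONS --safe #-}

-- A set on n lines has dimension at most 2n: a trace meets each line in an interval of X, which
-- is determined by its down-closure and its up-closure, and on each line each kind of closure
-- forms a chain. An infinite convexly independent set yields standard examples of every
-- dimension. Suppose finally that X is not covered by finitely many lines. If X is not covered by
-- finitely many flats p + ℝu + W for any finitely generated subspace W, it contains a linearly
-- independent sequence. Otherwise take W and w such that X is covered by finitely many flats
-- modulo W + ℝw, but not modulo W. Then the part of X on one of these flats is, modulo W, a
-- plane set not covered by finitely many lines. It contains a sequence no three points of which
-- are collinear and, by Ramsey's theorem, a subsequence all of whose triples have the same
-- orientation; there the line through the two neighbours of a point separates it from all other
-- points.
module Submission where

open import Defs
open import Algebra.Bundles using (CommutativeMonoid; CommutativeRing)
open import Algebra.Module.Bundles using (Module)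
import Algebra.Properties.Monoid.Sum as Sum
import Algebra.Properties.Ring
import Algebra.Solver.Ring as RingSolver
open import Algebra.Solver.Ring.AlmostCommutativeRing
  using (_-Raw-AlmostCommutative⟶_; fromCommutativeRing)
open import Axiom.ExcludedMiddle using (ExcludedMiddle)
open import Data.Bool.Base using (Bool; true; false)
open import Data.Fin.Base as Fin using (Fin; zero; suc; toℕ)
import Data.Fin.Properties as Fin
open import Data.Integer.Base as ℤ using (ℤ; +_; -[1+_])
import Data.Integer.Properties as ℤ
open import Data.List.Base as List using (List; []; _∷_; length; concatMap)
open import Data.List.Membership.Propositional using (lose) renaming (_∈_ to _∈ₗ_)
open import Data.List.Relation.Unary.Any as Any using (Any; here; there)
import Data.List.Relation.Unary.Any.Properties as Any
import Data.Maybe.Base as Maybe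
open import Data.Nat.Base as ℕ using (ℕ; zero; suc; z≤n; s≤s) renaming (_≤_ to _≤ₙ_; _<_ to _<ₙ_)
open import Data.Nat.Induction using (<-rec)
import Data.Nat.Properties as ℕ
open import Data.Product.Base using (Σ-syntax; ∃; ∃-syntax; ∃₂; _×_; _,_; proj₁; proj₂)
open import Data.Sign.Base as Sign using (Sign)
open import Data.Sum.Base using (_⊎_; inj₁; inj₂; [_,_]′)
open import Data.Unit.Base using (⊤; tt)
open import Data.Vec.Base as Vec using (Vec; []; _∷_; lookup; allFin)
import Data.Vec.Functional as Vector
open import Data.Vec.N-ary using (N-ary; _$ⁿ_)
open import Data.Vec.Relation.Unary.All as All using (All; []; _∷_)
open import Data.Vec.Relation.Unary.AllPairs using (AllPairs; []; _∷_)
open import Function.Base using (_∘_; id; flip; case_of_)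
open import Function.Bundles using (_⇔_; mk⇔)
open import Level using (Level; 0ℓ; _⊔_)
open import Relation.Binary.Bundles using (Poset; TotalOrder)
open import Relation.Binary.Core using (Rel)
open import Relation.Binary.Definitions using (tri<; tri≈; tri>)
open import Relation.Binary.Morphism.Structures using (IsOrderMonomorphism)
open import Relation.Binary.PropositionalEquality.Core as ≡ using (_≡_; _≢_)
import Relation.Binary.Reasoning.Setoid
open import Relation.Binary.Structures using (IsTotalOrder)
open import Relation.Nullary.Decidable.Core using (Dec; yes; no; does; decidable-stable; dec⇒maybe)
open import Relation.Nullary.Negation.Core using (¬_; contradiction)
open import Relation.Unary using (Pred; _∈_; _⊆_; _∩_)

-- Integer coefficients for the ring solver

module IntegerCoefficients {c ℓ : Level} (R : CommutativeRing c ℓ) where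

  open CommutativeRing R hiding (zero)
  open import Algebra.Properties.Ring ring
  open import Algebra.Properties.AbelianGroup +-abelianGroup using (⁻¹-∙-comm; ε⁻¹≈ε)
  open import Algebra.Properties.CommutativeSemigroup
    +-commutativeSemigroup using (interchange)
  open import Algebra.Properties.Semiring.Mult.TCOptimised semiring
    using (1+×; ×-homo-+; ×1-homo-*) renaming (_×_ to _⨯_)
  open import Relation.Binary.Reasoning.Setoid setoid

  -- For these multiples `1 ⨯ 1#` reduces to `1#`, so the constants 0 and 1 of a solver expression
  -- evaluate definitionally to `0#` and `1#`.
  fromℤ : ℤ → Carrier
  fromℤ (+ n)    = n ⨯ 1#
  fromℤ -[1+ n ] = - (suc n ⨯ 1#)

  fromℤ-⊖ : ∀ m n → fromℤ (m ℤ.⊖ n) ≈ m ⨯ 1# - n ⨯ 1#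
  fromℤ-⊖ m zero = sym (trans (+-congˡ ε⁻¹≈ε) (+-identityʳ _))
  fromℤ-⊖ zero (suc n) = sym (+-identityˡ _)
  fromℤ-⊖ (suc m) (suc n) = begin
    fromℤ (suc m ℤ.⊖ suc n)             ≡⟨ ≡.cong fromℤ (ℤ.[1+m]⊖[1+n]≡m⊖n m n) ⟩
    fromℤ (m ℤ.⊖ n)                     ≈⟨ fromℤ-⊖ m n ⟩
    m ⨯ 1# - n ⨯ 1#                     ≈⟨ +-identityˡ _ ⟨
    0# + (m ⨯ 1# - n ⨯ 1#)              ≈⟨ +-congʳ (-‿inverseʳ 1#) ⟨
    (1# - 1#) + (m ⨯ 1# - n ⨯ 1#)       ≈⟨ interchange _ _ _ _ ⟩
    (1# + m ⨯ 1#) + (- 1# - n ⨯ 1#)     ≈⟨ +-congˡ (⁻¹-∙-comm _ _) ⟩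
    (1# + m ⨯ 1#) - (1# + n ⨯ 1#)       ≈⟨ +-cong (1+× m 1#) (-‿cong (1+× n 1#)) ⟨
    suc m ⨯ 1# - suc n ⨯ 1#             ∎

  fromℤ-+ : ∀ i j → fromℤ (i ℤ.+ j) ≈ fromℤ i + fromℤ j
  fromℤ-+ (+ m)    (+ n)    = ×-homo-+ 1# m n
  fromℤ-+ (+ m)    -[1+ n ] = fromℤ-⊖ m (suc n)
  fromℤ-+ -[1+ m ] (+ n)    = trans (fromℤ-⊖ n (suc m)) (+-comm _ _)
  fromℤ-+ -[1+ m ] -[1+ n ] = begin
    - (suc (suc (m ℕ.+ n)) ⨯ 1#)          ≡⟨ ≡.cong (λ k → - (suc k ⨯ 1#)) (ℕ.+-suc m n) ⟨
    - ((suc m ℕ.+ suc n) ⨯ 1#)            ≈⟨ -‿cong (×-homo-+ 1# (suc m) (suc n)) ⟩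
    - (suc m ⨯ 1# + suc n ⨯ 1#)           ≈⟨ ⁻¹-∙-comm _ _ ⟨
    - (suc m ⨯ 1#) - suc n ⨯ 1#           ∎

  fromℤ-- : ∀ i → fromℤ (ℤ.- i) ≈ - fromℤ i
  fromℤ-- (+ zero)  = sym ε⁻¹≈ε
  fromℤ-- (+ suc n) = refl
  fromℤ-- -[1+ n ]  = sym (-‿involutive _)

  signed : Sign → Carrier → Carrier
  signed Sign.+ x = x
  signed Sign.- x = - x

  fromℤ-◃ : ∀ s n → fromℤ (s ℤ.◃ n) ≈ signed s (n ⨯ 1#)
  fromℤ-◃ Sign.+ zero    = refl
  fromℤ-◃ Sign.+ (suc n) = refl
  fromℤ-◃ Sign.- zero    = sym ε⁻¹≈ε
  fromℤ-◃ Sign.- (suc n) = refl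

  signed-* : ∀ s t x y → signed (s Sign.* t) (x * y) ≈ signed s x * signed t y
  signed-* Sign.+ Sign.+ x y = refl
  signed-* Sign.+ Sign.- x y = -‿distribʳ-* x y
  signed-* Sign.- Sign.+ x y = -‿distribˡ-* x y
  signed-* Sign.- Sign.- x y = begin
    x * y         ≈⟨ -‿involutive _ ⟨
    - - (x * y)   ≈⟨ -‿cong (-‿distribʳ-* x y) ⟩
    - (x * - y)   ≈⟨ -‿distribˡ-* x (- y) ⟩
    - x * - y     ∎

  fromℤ-signed : ∀ i → signed (ℤ.sign i) (ℤ.∣ i ∣ ⨯ 1#) ≈ fromℤ i
  fromℤ-signed (+ n)    = refl
  fromℤ-signed -[1+ n ] = refl

  -- Integer multiplication is defined through signs and absolute values, hence the detour through
  -- `signed`.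
  fromℤ-* : ∀ i j → fromℤ (i ℤ.* j) ≈ fromℤ i * fromℤ j
  fromℤ-* i j = begin
    fromℤ (s ℤ.◃ m ℕ.* n)                 ≈⟨ fromℤ-◃ s (m ℕ.* n) ⟩
    signed s ((m ℕ.* n) ⨯ 1#)             ≈⟨ signed-cong s (×1-homo-* m n) ⟩
    signed s (m ⨯ 1# * n ⨯ 1#)            ≈⟨ signed-* (ℤ.sign i) (ℤ.sign j) _ _ ⟩
    signed (ℤ.sign i) (m ⨯ 1#) * signed (ℤ.sign j) (n ⨯ 1#)
                                          ≈⟨ *-cong (fromℤ-signed i) (fromℤ-signed j) ⟩
    fromℤ i * fromℤ j                     ∎
    where
    s = ℤ.sign i Sign.* ℤ.sign j
    m = ℤ.∣ i ∣
    n = ℤ.∣ j ∣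
    signed-cong : ∀ s {x y} → x ≈ y → signed s x ≈ signed s y
    signed-cong Sign.+ x≈y = x≈y
    signed-cong Sign.- x≈y = -‿cong x≈y

  -- Equality is decidable in ℤ, while it is not assumed so in `R`: with integer coefficients the
  -- solver recognises vanishing coefficients, and cancellation happens by computation.
  fromℤ-morphism : ℤ.+-*-rawRing -Raw-AlmostCommutative⟶ fromCommutativeRing R
  fromℤ-morphism = record
    { ⟦_⟧    = fromℤ
    ; +-homo = fromℤ-+
    ; *-homo = fromℤ-*
    ; -‿homo = fromℤ--
    ; 0-homo = refl
    ; 1-homo = refl
    }

  open RingSolver ℤ.+-*-rawRing (fromCommutativeRing R) fromℤ-morphism
    (λ i j → Maybe.map (λ i≡j → reflexive (≡.cong fromℤ i≡j)) (dec⇒maybe (i ℤ.≟ j)))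
    public

-- Solver for equations between linear combinations

-- An equation between linear combinations of vectors is reduced to the equality of the
-- polynomial normal forms of the coefficients.
module ModuleSolver {c ℓ m ℓm : Level} (R : CommutativeRing c ℓ) (V : Module R m ℓm) where

  open CommutativeRing R hiding (zero)
  open Module V
  open import Algebra.Properties.CommutativeSemigroup
    (CommutativeMonoid.commutativeSemigroup +ᴹ-commutativeMonoid) using (interchange)
  open IntegerCoefficients R
    using (Polynomial; Normal; normalise; ⟦_⟧; ⟦_⟧N; correct; var; con; _:+_; _:*_; :-_)
  open import Relation.Binary.Reasoning.Setoid ≈ᴹ-setoid

  infixl 6 _⊕_
  infixr 7 _⊙_

  data Combination (k n : ℕ) : Set where
    vec : Fin n → Combination k n
    _⊕_ : Combination k n → Combination k n → Combination k n
    _⊙_ : Polynomial k → Combination k n → Combination k n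
    𝟎   : Combination k n

  private variable k n : ℕ

  eval : Combination k n → Vec Carrier k → Vec Carrierᴹ n → Carrierᴹ
  eval (vec i) ρ σ = lookup σ i
  eval (d ⊕ e) ρ σ = eval d ρ σ +ᴹ eval e ρ σ
  eval (p ⊙ e) ρ σ = ⟦ p ⟧ ρ *ₗ eval e ρ σ
  eval 𝟎       ρ σ = 0ᴹ

  δ : Fin n → Fin n → Polynomial k
  δ zero    zero    = con (+ 1)
  δ zero    (suc j) = con (+ 0)
  δ (suc i) zero    = con (+ 0)
  δ (suc i) (suc j) = δ i j

  coefficient : Combination k n → Fin n → Polynomial k
  coefficient (vec i) j = δ i j
  coefficient (d ⊕ e) j = coefficient d j :+ coefficient e j
  coefficient (p ⊙ e) j = p :* coefficient e j
  coefficient 𝟎       j = con (+ 0)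

  Σ[_]* : (Fin n → Carrier) → Vec Carrierᴹ n → Carrierᴹ
  Σ[ t ]* []      = 0ᴹ
  Σ[ t ]* (v ∷ σ) = t zero *ₗ v +ᴹ Σ[ (λ i → t (suc i)) ]* σ

  Σ-zero : (t : Fin n → Carrier) (σ : Vec Carrierᴹ n) → (∀ i → t i ≈ 0#) → Σ[ t ]* σ ≈ᴹ 0ᴹ
  Σ-zero t []      t≈0 = ≈ᴹ-refl
  Σ-zero t (v ∷ σ) t≈0 = begin
    t zero *ₗ v +ᴹ Σ[ _ ]* σ  ≈⟨ +ᴹ-cong (*ₗ-congʳ (t≈0 zero)) (Σ-zero _ σ (λ i → t≈0 (suc i))) ⟩
    0# *ₗ v +ᴹ 0ᴹ             ≈⟨ +ᴹ-identityʳ _ ⟩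
    0# *ₗ v                   ≈⟨ *ₗ-zeroˡ v ⟩
    0ᴹ                        ∎

  Σ-δ : (i : Fin n) (ρ : Vec Carrier k) (σ : Vec Carrierᴹ n) →
        lookup σ i ≈ᴹ Σ[ (λ j → ⟦ δ i j ⟧ ρ) ]* σ
  Σ-δ zero ρ (v ∷ σ) = ≈ᴹ-sym (begin
    1# *ₗ v +ᴹ Σ[ _ ]* σ  ≈⟨ +ᴹ-cong (*ₗ-identityˡ v) (Σ-zero _ σ (λ _ → refl)) ⟩
    v +ᴹ 0ᴹ               ≈⟨ +ᴹ-identityʳ v ⟩
    v                     ∎)
  Σ-δ (suc i) ρ (v ∷ σ) = ≈ᴹ-sym (begin
    0# *ₗ v +ᴹ Σ[ _ ]* σ  ≈⟨ +ᴹ-cong (*ₗ-zeroˡ v) (≈ᴹ-sym (Σ-δ i ρ σ)) ⟩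
    0ᴹ +ᴹ lookup σ i      ≈⟨ +ᴹ-identityˡ _ ⟩
    lookup σ i            ∎)

  Σ-+ : (s t : Fin n → Carrier) (σ : Vec Carrierᴹ n) →
        Σ[ s ]* σ +ᴹ Σ[ t ]* σ ≈ᴹ Σ[ (λ i → s i + t i) ]* σ
  Σ-+ s t []      = +ᴹ-identityˡ 0ᴹ
  Σ-+ s t (v ∷ σ) = ≈ᴹ-trans (interchange _ _ _ _)
    (+ᴹ-cong (≈ᴹ-sym (*ₗ-distribʳ v _ _)) (Σ-+ _ _ σ))

  Σ-* : (s : Carrier) (t : Fin n → Carrier) (σ : Vec Carrierᴹ n) →
        s *ₗ Σ[ t ]* σ ≈ᴹ Σ[ (λ i → s * t i) ]* σ
  Σ-* s t []      = *ₗ-zeroʳ s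
  Σ-* s t (v ∷ σ) = ≈ᴹ-trans (*ₗ-distribˡ s _ _) (+ᴹ-cong (≈ᴹ-sym (*ₗ-assoc s _ v)) (Σ-* s _ σ))

  eval-coefficient : (e : Combination k n) (ρ : Vec Carrier k) (σ : Vec Carrierᴹ n) →
                     eval e ρ σ ≈ᴹ Σ[ (λ i → ⟦ coefficient e i ⟧ ρ) ]* σ
  eval-coefficient (vec i) ρ σ = Σ-δ i ρ σ
  eval-coefficient (d ⊕ e) ρ σ =
    ≈ᴹ-trans (+ᴹ-cong (eval-coefficient d ρ σ) (eval-coefficient e ρ σ)) (Σ-+ _ _ σ)
  eval-coefficient (p ⊙ e) ρ σ =
    ≈ᴹ-trans (*ₗ-congˡ (eval-coefficient e ρ σ)) (Σ-* _ _ σ)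
  eval-coefficient 𝟎       ρ σ = ≈ᴹ-sym (Σ-zero _ σ (λ _ → refl))

  -- Gathering the normal forms in one vector turns the comparison of all coefficients into a single
  -- propositional equality, which `≡.refl` proves at each use of `solveᴹ`.
  normals : Combination k n → Vec (Normal k) n
  normals e = Vec.tabulate (λ i → normalise (coefficient e i))

  evalNormals : Vec (Normal k) n → Vec Carrier k → Vec Carrierᴹ n → Carrierᴹ
  evalNormals ps ρ σ = Vec.foldr′ _+ᴹ_ 0ᴹ (Vec.zipWith (λ p v → ⟦ p ⟧N ρ *ₗ v) ps σ)

  evalNormals-tabulate : (p : Fin n → Polynomial k) (ρ : Vec Carrier k) (σ : Vec Carrierᴹ n) →
    evalNormals (Vec.tabulate (λ i → normalise (p i))) ρ σ ≈ᴹ Σ[ (λ i → ⟦ p i ⟧ ρ) ]* σ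
  evalNormals-tabulate p ρ []      = ≈ᴹ-refl
  evalNormals-tabulate p ρ (v ∷ σ) =
    +ᴹ-cong (*ₗ-congʳ (correct (p zero) ρ)) (evalNormals-tabulate (λ i → p (suc i)) ρ σ)

  eval-normals : (e : Combination k n) (ρ : Vec Carrier k) (σ : Vec Carrierᴹ n) →
                 eval e ρ σ ≈ᴹ evalNormals (normals e) ρ σ
  eval-normals e ρ σ =
    ≈ᴹ-trans (eval-coefficient e ρ σ) (≈ᴹ-sym (evalNormals-tabulate (coefficient e) ρ σ))

  Equation : ℕ → ℕ → Set
  Equation k n = Combination k n × Combination k n

  infix 4 _⊜_

  _⊜_ : Combination k n → Combination k n → Equation k n
  _⊜_ = _,_

  close : N-ary k (Polynomial k) (N-ary n (Combination k n) (Equation k n)) → Equation k n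
  close {k} {n} f = (f $ⁿ Vec.map var (allFin k)) $ⁿ Vec.map vec (allFin n)

  solveᴹ : (ρ : Vec Carrier k) (σ : Vec Carrierᴹ n)
           (f : N-ary k (Polynomial k) (N-ary n (Combination k n) (Equation k n))) →
           let d , e = close f in normals d ≡ normals e → eval d ρ σ ≈ᴹ eval e ρ σ
  solveᴹ ρ σ f d≡e = begin
    eval d ρ σ                  ≈⟨ eval-normals d ρ σ ⟩
    evalNormals (normals d) ρ σ ≡⟨ ≡.cong (λ ps → evalNormals ps ρ σ) d≡e ⟩
    evalNormals (normals e) ρ σ ≈⟨ eval-normals e ρ σ ⟨
    eval e ρ σ                  ∎
    where
    d = proj₁ (close f)
    e = proj₂ (close f)

-- Sequences chosen against their finite history

module GreedySequence {a p} {A : Set a} {P : List A → A → Set p}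
                      (extend : ∀ l → ∃[ x ] P l x) where

  history : ℕ → List A
  sequence : ℕ → A

  history zero    = []
  history (suc n) = sequence n ∷ history n

  sequence n = proj₁ (extend (history n))

  sequence-extends : ∀ n → P (history n) (sequence n)
  sequence-extends n = proj₂ (extend (history n))

  sequence∈history : ∀ {i n} → i <ₙ n → sequence i ∈ₗ history n
  sequence∈history {i} {suc n} (s≤s i≤n) with ℕ.m≤n⇒m<n∨m≡n i≤n
  ... | inj₁ i<n    = there (sequence∈history i<n)
  ... | inj₂ ≡.refl = here ≡.refl

-- Strictly increasing sequences and infinite sets of natural numbers

StrictlyIncreasing : (ℕ → ℕ) → Set
StrictlyIncreasing h = ∀ {i j} → i <ₙ j → h i <ₙ h j

step⇒strictlyIncreasing : ∀ {h} → (∀ n → h n <ₙ h (suc n)) → StrictlyIncreasing h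
step⇒strictlyIncreasing {h} step {i} {suc j} (s≤s i≤j) with ℕ.m≤n⇒m<n∨m≡n i≤j
... | inj₁ i<j    = ℕ.<-trans (step⇒strictlyIncreasing {h} step i<j) (step j)
... | inj₂ ≡.refl = step i

strictlyIncreasing⇒≤ : ∀ {h} → StrictlyIncreasing h → ∀ n → n ≤ₙ h n
strictlyIncreasing⇒≤ h↑ zero    = z≤n
strictlyIncreasing⇒≤ h↑ (suc n) = ℕ.≤-<-trans (strictlyIncreasing⇒≤ h↑ n) (h↑ (ℕ.n<1+n n))

strictlyIncreasing-reflects-< : ∀ {h} → StrictlyIncreasing h → ∀ {i j} → h i <ₙ h j → i <ₙ j
strictlyIncreasing-reflects-< h↑ {i} {j} hi<hj with ℕ.<-cmp i j
... | tri< i<j _ _    = i<j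
... | tri≈ _ ≡.refl _ = contradiction hi<hj (ℕ.<-irrefl ≡.refl)
... | tri> _ _ j<i    = contradiction (ℕ.<-trans hi<hj (h↑ j<i)) (ℕ.<-irrefl ≡.refl)

Unbounded : Pred ℕ 0ℓ → Set
Unbounded S = ∀ n → ∃[ m ] (n <ₙ m × m ∈ S)

enumerate : ∀ {S} → Unbounded S → Σ[ h ∈ (ℕ → ℕ) ] (StrictlyIncreasing h × (∀ n → h n ∈ S))
enumerate {S} S∞ = h , step⇒strictlyIncreasing {h} h-step , h∈S
  where
  h : ℕ → ℕ
  h zero    = proj₁ (S∞ zero)
  h (suc n) = proj₁ (S∞ (h n))
  h-step : ∀ n → h n <ₙ h (suc n)
  h-step n = proj₁ (proj₂ (S∞ (h n)))
  h∈S : ∀ n → h n ∈ S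
  h∈S zero    = proj₂ (proj₂ (S∞ zero))
  h∈S (suc n) = proj₂ (proj₂ (S∞ (h n)))

above : ∀ {S} → Unbounded S → ∀ a → Unbounded (S ∩ (a <ₙ_))
above S∞ a n with m , n⊔a<m , m∈S ← S∞ (n ℕ.⊔ a) =
  m , ℕ.≤-<-trans (ℕ.m≤m⊔n n a) n⊔a<m , m∈S , ℕ.≤-<-trans (ℕ.m≤n⊔m n a) n⊔a<m

-- Ramsey's theorem

Homogeneous : ∀ {r} → (Vec ℕ r → Bool) → Pred ℕ 0ℓ → Bool → Set
Homogeneous f S b = ∀ {l} → All S l → AllPairs _<ₙ_ l → f l ≡ b

module Classical (em : ∀ {a} → ExcludedMiddle a) where

  least : ∀ {p} {P : ℕ → Set p} → ∃ P → ∃[ n ] (P n × (∀ {m} → P m → n ≤ₙ m))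
  least {P = P} (n , Pn) = <-rec (λ n → P n → _) search n Pn
    where
    search : ∀ n → (∀ {m} → m <ₙ n → P m → _) → P n → ∃[ n ] (P n × (∀ {m} → P m → n ≤ₙ m))
    search n rec Pn with em {P = ∃[ m ] (m <ₙ n × P m)}
    ... | yes (m , m<n , Pm) = rec m<n Pm
    ... | no  minimal        = n , Pn , λ Pm → ℕ.≮⇒≥ (λ m<n → minimal (_ , m<n , Pm))

  unboundedColour : (b : ℕ → Bool) → ∃[ c ] Unbounded (λ n → b n ≡ c)
  unboundedColour b with em {P = Unbounded (λ n → b n ≡ true)}
  ... | yes true∞ = true , true∞
  ... | no ¬true∞ = false , false∞
    where
    false∞ : Unbounded (λ n → b n ≡ false)
    false∞ n with em {P = ∃[ m ] (n <ₙ m × b m ≡ false)}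
    ... | yes found = found
    ... | no absent = contradiction true∞ ¬true∞
      where
      true∞ : Unbounded (λ m → b m ≡ true)
      true∞ k = m , s≤s (ℕ.m≤n⊔m n k) , bm
        where
        -- Beyond `k`, as required here, and beyond `n`, so that `absent` rules out the colour
        -- `false`.
        m = suc (n ℕ.⊔ k)
        bm : b m ≡ true
        bm with b m in eq
        ... | true  = ≡.refl
        ... | false = contradiction (m , s≤s (ℕ.m≤m⊔n n k) , eq) absent

  -- Induction on the size of the tuples. Each stage picks an element `a n` of the current set and
  -- shrinks the set to later elements on which the colouring with `a n` prefixed is homogeneous.
  -- The colour of an increasing tuple of chosen elements then depends only on its first entry, and
  -- it remains to keep the entries of a colour that recurs unboundedly.
  ramsey : ∀ r (f : Vec ℕ r → Bool) {S} → Unbounded S →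
           ∃[ T ] (T ⊆ S × Unbounded T × ∃ (Homogeneous f T))
  ramsey zero    f {S} S∞ = S , id , S∞ , f [] , λ { [] [] → ≡.refl }
  ramsey (suc r) f {S} S∞ = T , T⊆S , T∞ , c , homogeneous
    where
    refine : ((U , U∞) : ∃ Unbounded) → let a , _ = U∞ zero in
             ∃[ U′ ] (U′ ⊆ U ∩ (a <ₙ_) × Unbounded U′ × ∃ (Homogeneous (f ∘ (a ∷_)) U′))
    refine (U , U∞) = ramsey r _ (above U∞ _)

    stage : ℕ → ∃ Unbounded
    stage zero    = S , S∞
    stage (suc n) with U′ , _ , U′∞ , _ ← refine (stage n) = U′ , U′∞

    U : ℕ → Pred ℕ 0ℓ
    U n = proj₁ (stage n)

    a : ℕ → ℕ
    a n = proj₁ (proj₂ (stage n) zero)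

    a∈U : ∀ n → a n ∈ U n
    a∈U n = proj₂ (proj₂ (proj₂ (stage n) zero))

    U-step : ∀ n → U (suc n) ⊆ U n ∩ (a n <ₙ_)
    U-step n = proj₁ (proj₂ (refine (stage n)))

    colour : ℕ → Bool
    colour n = proj₁ (proj₂ (proj₂ (proj₂ (refine (stage n)))))

    colour-homogeneous : ∀ n → Homogeneous (f ∘ (a n ∷_)) (U (suc n)) (colour n)
    colour-homogeneous n = proj₂ (proj₂ (proj₂ (proj₂ (refine (stage n)))))

    U-antitone : ∀ {m n} → m ≤ₙ n → U n ⊆ U m
    U-antitone {m} {n} m≤n with ℕ.m≤n⇒m<n∨m≡n m≤n
    U-antitone {m} {suc n} _ | inj₁ (s≤s m≤n) = U-antitone {m} {n} m≤n ∘ proj₁ ∘ U-step n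
    U-antitone {m} {n}     _ | inj₂ ≡.refl    = id

    a↑ : StrictlyIncreasing a
    a↑ = step⇒strictlyIncreasing {a} (λ n → proj₂ (U-step n (a∈U (suc n))))

    c = proj₁ (unboundedColour colour)
    c∞ = proj₂ (unboundedColour colour)

    T : Pred ℕ 0ℓ
    T m = ∃[ n ] (colour n ≡ c × m ≡ a n)

    T⊆S : T ⊆ S
    T⊆S (n , _ , ≡.refl) = U-antitone {0} {n} z≤n (a∈U n)

    T∞ : Unbounded T
    T∞ k with n , k<n , bn ← c∞ k =
      a n , ℕ.<-≤-trans k<n (strictlyIncreasing⇒≤ {a} a↑ n) , n , bn , ≡.refl

    homogeneous : Homogeneous f T c
    homogeneous ((n , bn , ≡.refl) ∷ l∈T) (an<l ∷ l↑) = ≡.trans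
      (colour-homogeneous n (All.map later (All.zip (l∈T , an<l))) l↑) bn
      where
      -- From `a n < a n′` follows `n < n′`, so `a n′` was chosen after the shrinking at stage `n`
      -- and lies in `U (suc n)`.
      later : ∀ {m} → T m × a n <ₙ m → m ∈ U (suc n)
      later ((n′ , _ , ≡.refl) , an<an′) =
        U-antitone {suc n} {n′} (strictlyIncreasing-reflects-< {a} a↑ {n} an<an′) (a∈U n′)

  ramsey-triples : (f : ℕ → ℕ → ℕ → Bool) → ∃[ b ] Σ[ h ∈ (ℕ → ℕ) ] (StrictlyIncreasing h ×
                   (∀ {i j k} → i <ₙ j → j <ₙ k → f (h i) (h j) (h k) ≡ b))
  ramsey-triples f
    with T , _ , T∞ , b , homogeneous ← ramsey 3 (λ { (i ∷ j ∷ k ∷ []) → f i j k }) {λ _ → ⊤}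
           (λ n → suc n , ℕ.n<1+n n , tt)
    with h , h↑ , h∈T ← enumerate T∞ = b , h , h↑ , λ {i} {j} {k} i<j j<k →
      homogeneous {h i ∷ h j ∷ h k ∷ []} (h∈T i ∷ h∈T j ∷ h∈T k ∷ [])
        ((h↑ i<j ∷ h↑ (ℕ.<-trans i<j j<k) ∷ []) ∷ (h↑ j<k ∷ []) ∷ [] ∷ [])

module ConvexPosition (em : ∀ {a} → ExcludedMiddle a) {ℓ} (ℝ : RealField ℓ) (V : RealVectorSpace ℝ) where

  open RealField ℝ hiding (zero)
  open Module V
  open Convexity ℝ V
  open Sum +-monoid using (sum)
  open Sum +ᴹ-monoid using () renaming (sum to sumᴹ)
  open IntegerCoefficients commutativeRing
    using (con; :-_; _:+_; _:*_; _:-_; _:=_; solve)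
  open ModuleSolver commutativeRing V using (_⊕_; _⊙_; 𝟎; _⊜_; solveᴹ)
  open Algebra.Properties.Ring ring using (-0#≈0#; -‿involutive; -1*x≈-x; -‿distribʳ-*)
  open Classical em
  private
    module O = IsTotalOrder isTotalOrder
    module ≈-Reasoning = Relation.Binary.Reasoning.Setoid setoid
    module ≈ᴹ-Reasoning = Relation.Binary.Reasoning.Setoid ≈ᴹ-setoid

  -- Inequalities in an ordered field

  x≤0⇒0≤-x : ∀ {x} → x ≤ 0# → 0# ≤ - x
  x≤0⇒0≤-x {x} x≤0 =
    O.≤-respˡ-≈ (-‿inverseʳ x) (O.≤-respʳ-≈ (+-identityˡ (- x)) (+-monoˡ-≤ (- x) x≤0))

  0≤-x⇒x≤0 : ∀ {x} → 0# ≤ - x → x ≤ 0#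
  0≤-x⇒x≤0 {x} 0≤-x =
    O.≤-respˡ-≈ (+-identityˡ x) (O.≤-respʳ-≈ (-‿inverseˡ x) (+-monoˡ-≤ x 0≤-x))

  x≤y⇒0≤y-x : ∀ {x y} → x ≤ y → 0# ≤ y - x
  x≤y⇒0≤y-x {x} x≤y = O.≤-respˡ-≈ (-‿inverseʳ x) (+-monoˡ-≤ (- x) x≤y)

  +-nonNeg : ∀ {x y} → 0# ≤ x → 0# ≤ y → 0# ≤ x + y
  +-nonNeg {x} {y} 0≤x 0≤y =
    O.trans 0≤y (O.≤-respˡ-≈ (+-identityˡ y) (+-monoˡ-≤ y 0≤x))

  0≤1 : 0# ≤ 1#
  0≤1 with O.total 0# 1#
  ... | inj₁ 0≤1 = 0≤1
  ... | inj₂ 1≤0 = O.≤-respʳ-≈ (solve 0 (:- con (+ 1) :* :- con (+ 1) := con (+ 1)) refl)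
    (*-nonNeg (x≤0⇒0≤-x 1≤0) (x≤0⇒0≤-x 1≤0))

  inverse-nonNeg : ∀ {x y} → 0# ≤ x → x * y ≈ 1# → 0# ≤ y
  inverse-nonNeg {x} {y} 0≤x xy≈1 with O.total 0# y
  ... | inj₁ 0≤y = 0≤y
  ... | inj₂ y≤0 = contradiction (O.antisym 0≤1 (0≤-x⇒x≤0 0≤-1)) 0≉1
    where
    0≤-1 : 0# ≤ - 1#
    0≤-1 = O.≤-respʳ-≈
      (trans (solve 2 (λ x y → x :* :- y := :- (x :* y)) refl x y) (-‿cong xy≈1))
      (*-nonNeg 0≤x (x≤0⇒0≤-x y≤0))

  -- Cones and convex hulls

  -- Convexity in homogenised form: a convex cone in ℝ × V, whose slice at height 1 is a convex set.
  -- Closure under sums and nonnegative multiples avoids normalising weights.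
  record IsCone {p} (B : Carrier → Pred Carrierᴹ p) : Set (ℓ ⊔ p) where
    field
      respects : ∀ {a b x y} → a ≈ b → x ≈ᴹ y → B a x → B b y
      origin   : B 0# 0ᴹ
      add      : ∀ {a b x y} → B a x → B b y → B (a + b) (x +ᴹ y)
      scale    : ∀ {s a x} → 0# ≤ s → B a x → B (s * a) (s *ₗ x)

  -- The convex hull at height a, so that conv Y is definitionally cone Y 1#.
  cone : Pred Carrierᴹ ℓ → Carrier → Pred Carrierᴹ ℓ
  cone Y a x = ∃[ n ] Σ[ t ∈ (Fin n → Carrier) ] Σ[ p ∈ (Fin n → Carrierᴹ) ]
    ((∀ i → 0# ≤ t i) × (∀ i → p i ∈ Y) × sum t ≈ a × x ≈ᴹ sumᴹ (λ i → t i *ₗ p i))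

  module _ (Y : Pred Carrierᴹ ℓ) where

    -- This is the tool for keeping a point out of a hull: it suffices to exhibit a cone that
    -- contains the generators at height 1 but misses the point.
    cone-⊆ : ∀ {p} {B : Carrier → Pred Carrierᴹ p} → IsCone B → (∀ {y} → y ∈ Y → B 1# y) →
             ∀ {a x} → cone Y a x → B a x
    cone-⊆ {B = B} isCone Y⊆B (n , t , p , 0≤t , p∈Y , Σt≈a , x≈Σtp) =
      respects Σt≈a (≈ᴹ-sym x≈Σtp) (sums n t p 0≤t p∈Y)
      where
      open IsCone isCone
      sums : ∀ n (t : Fin n → Carrier) (p : Fin n → Carrierᴹ) → (∀ i → 0# ≤ t i) →
             (∀ i → p i ∈ Y) → B (sum t) (sumᴹ (λ i → t i *ₗ p i))
      sums zero    t p 0≤t p∈Y = origin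
      sums (suc n) t p 0≤t p∈Y = add
        (respects (*-identityʳ _) ≈ᴹ-refl (scale (0≤t zero) (Y⊆B (p∈Y zero))))
        (sums n (t ∘ suc) (p ∘ suc) (0≤t ∘ suc) (p∈Y ∘ suc))

    cone-respects : ∀ {a b x y} → a ≈ b → x ≈ᴹ y → cone Y a x → cone Y b y
    cone-respects a≈b x≈y (n , t , p , 0≤t , p∈Y , Σt≈a , x≈Σtp) =
      n , t , p , 0≤t , p∈Y , trans Σt≈a a≈b , ≈ᴹ-trans (≈ᴹ-sym x≈y) x≈Σtp

    cone-cons : ∀ {s y a x} → 0# ≤ s → y ∈ Y → cone Y a x → cone Y (s + a) (s *ₗ y +ᴹ x)
    cone-cons {s} {y} 0≤s y∈Y (n , t , p , 0≤t , p∈Y , Σt≈a , x≈Σtp) =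
      suc n , (s Vector.∷ t) , (y Vector.∷ p) ,
      (λ { zero → 0≤s ; (suc i) → 0≤t i }) , (λ { zero → y∈Y ; (suc i) → p∈Y i }) ,
      +-congˡ Σt≈a , +ᴹ-congˡ x≈Σtp

    cone-zero : cone Y 0# 0ᴹ
    cone-zero = 0 , (λ ()) , (λ ()) , (λ ()) , (λ ()) , refl , ≈ᴹ-refl

    cone-add : ∀ {a b x y} → cone Y a x → cone Y b y → cone Y (a + b) (x +ᴹ y)
    cone-add {b = b} {y = y} (n , t , p , 0≤t , p∈Y , Σt≈a , x≈Σtp) c =
      cone-respects (+-congʳ Σt≈a) (+ᴹ-congʳ (≈ᴹ-sym x≈Σtp)) (sums n t p 0≤t p∈Y)
      where
      sums : ∀ n (t : Fin n → Carrier) (p : Fin n → Carrierᴹ) → (∀ i → 0# ≤ t i) →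
             (∀ i → p i ∈ Y) → cone Y (sum t + b) (sumᴹ (λ i → t i *ₗ p i) +ᴹ y)
      sums zero    t p 0≤t p∈Y = cone-respects (sym (+-identityˡ b)) (≈ᴹ-sym (+ᴹ-identityˡ y)) c
      sums (suc n) t p 0≤t p∈Y = cone-respects (sym (+-assoc _ _ b)) (≈ᴹ-sym (+ᴹ-assoc _ _ y))
        (cone-cons (0≤t zero) (p∈Y zero) (sums n (t ∘ suc) (p ∘ suc) (0≤t ∘ suc) (p∈Y ∘ suc)))

    cone-scale : ∀ {s a x} → 0# ≤ s → cone Y a x → cone Y (s * a) (s *ₗ x)
    cone-scale {s} 0≤s (n , t , p , 0≤t , p∈Y , Σt≈a , x≈Σtp) =
      cone-respects (*-congˡ Σt≈a) (*ₗ-congˡ (≈ᴹ-sym x≈Σtp)) (sums n t p 0≤t p∈Y)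
      where
      sums : ∀ n (t : Fin n → Carrier) (p : Fin n → Carrierᴹ) → (∀ i → 0# ≤ t i) →
             (∀ i → p i ∈ Y) → cone Y (s * sum t) (s *ₗ sumᴹ (λ i → t i *ₗ p i))
      sums zero    t p 0≤t p∈Y = cone-respects (sym (zeroʳ s)) (≈ᴹ-sym (*ₗ-zeroʳ s)) cone-zero
      sums (suc n) t p 0≤t p∈Y = cone-respects (sym (distribˡ s _ _))
        (≈ᴹ-sym (≈ᴹ-trans (*ₗ-distribˡ s _ _) (+ᴹ-congʳ (≈ᴹ-sym (*ₗ-assoc s _ _)))))
        (cone-cons (*-nonNeg 0≤s (0≤t zero)) (p∈Y zero)
          (sums n (t ∘ suc) (p ∘ suc) (0≤t ∘ suc) (p∈Y ∘ suc)))

    ∈-conv : ∀ {y} → y ∈ Y → y ∈ conv Y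
    ∈-conv {y} y∈Y = cone-respects (+-identityʳ 1#)
      (≈ᴹ-trans (+ᴹ-identityʳ _) (*ₗ-identityˡ y)) (cone-cons 0≤1 y∈Y cone-zero)

  convexHull : Pred Carrierᴹ ℓ → Subset
  convexHull Y = record { mem = conv Y ; resp = cone-respects Y refl }

  convexHull-convex : ∀ Y → Convex (convexHull Y)
  convexHull-convex Y {s = s} {t} x∈C y∈C 0≤s 0≤t s+t≈1 = cone-respects Y
    (trans (+-cong (*-identityʳ s) (*-identityʳ t)) s+t≈1) ≈ᴹ-refl
    (cone-add Y (cone-scale Y 0≤s x∈C) (cone-scale Y 0≤t y∈C))

  -- Convexly independent sequences from separating cones

  range : (ℕ → Carrierᴹ) → Subset
  range x = record
    { mem  = λ v → ∃[ n ] v ≈ᴹ x n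
    ; resp = λ { u≈v (n , u≈xn) → n , ≈ᴹ-trans (≈ᴹ-sym u≈v) u≈xn }
    }

  -- Pigeonhole: among the first `suc (length ys)` terms, two would be matched with the same entry
  -- of a covering list.
  range-infinite : ∀ {x} → (∀ {i j} → i <ₙ j → ¬ (x i ≈ᴹ x j)) → Infinite (range x)
  range-infinite {x} distinct (ys , covers) = distinct i<j (begin
    x (toℕ i)                      ≈⟨ Any.lookup-index (listed i) ⟩
    List.lookup ys (position i)    ≡⟨ ≡.cong (List.lookup ys) pi≡pj ⟩
    List.lookup ys (position j)    ≈⟨ Any.lookup-index (listed j) ⟨
    x (toℕ j)                      ∎)
    where
    open ≈ᴹ-Reasoning
    listed : (i : Fin (suc (length ys))) → Any (x (toℕ i) ≈ᴹ_) ys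
    listed i = covers (toℕ i , ≈ᴹ-refl)
    position : Fin (suc (length ys)) → Fin (length ys)
    position i = Any.index (listed i)
    repeated = Fin.pigeonhole (ℕ.n<1+n _) position
    i = proj₁ repeated
    j = proj₁ (proj₂ repeated)
    i<j = proj₁ (proj₂ (proj₂ repeated))
    pi≡pj = proj₂ (proj₂ (proj₂ repeated))

  -- The slice of `B j` at height 1 contains every term except `x j`, hence also the hull of the
  -- other terms. The same cones show that the terms are distinct.
  separated⇒infiniteIndependent : ∀ X (x : ℕ → Carrierᴹ) → (∀ n → x n ∈ mem X) →
    (B : ℕ → Carrier → Pred Carrierᴹ ℓ) → (∀ j → IsCone (B j)) →
    (∀ {j n} → n ≢ j → B j 1# (x n)) → (∀ j → ¬ B j 1# (x j)) →
    HasInfiniteConvexlyIndependentSubset X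
  separated⇒infiniteIndependent X x x∈X B B-cone inside outside =
    range x , (λ { (n , v≈xn) → resp X (≈ᴹ-sym v≈xn) (x∈X n) }) ,
    range-infinite distinct , independent
    where
    distinct : ∀ {i j} → i <ₙ j → ¬ (x i ≈ᴹ x j)
    distinct {i} {j} i<j xi≈xj =
      outside j (IsCone.respects (B-cone j) refl xi≈xj (inside (ℕ.<⇒≢ i<j)))
    independent : ConvexlyIndependent (range x)
    independent (j , y≈xj) y∈conv = outside j (IsCone.respects (B-cone j) refl y≈xj
      (cone-⊆ _ (B-cone j) others y∈conv))
      where
      others : ∀ {v} → v ∈ (mem (range x) ∖ _) → B j 1# v
      others ((n , v≈xn) , v≉y) = IsCone.respects (B-cone j) refl (≈ᴹ-sym v≈xn)
        (inside (λ { ≡.refl → v≉y (≈ᴹ-trans v≈xn (≈ᴹ-sym y≈xj)) }))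

  -- Spans and linearly independent sequences

  -- An inductive closure instead of explicit coefficient lists: membership is built by
  -- constructors, and a single coefficient is extracted by `Span-split` where one is wanted.
  data Span (P : Pred Carrierᴹ ℓ) : Pred Carrierᴹ ℓ where
    generator : ∀ {v} → v ∈ P → v ∈ Span P
    zero      : 0ᴹ ∈ Span P
    add       : ∀ {v w} → v ∈ Span P → w ∈ Span P → v +ᴹ w ∈ Span P
    scale     : ∀ s {v} → v ∈ Span P → s *ₗ v ∈ Span P
    respects  : ∀ {v w} → v ≈ᴹ w → v ∈ Span P → w ∈ Span P

  Span-mono : ∀ {P Q} → P ⊆ Q → Span P ⊆ Span Q
  Span-mono P⊆Q (generator v∈P)  = generator (P⊆Q v∈P)
  Span-mono P⊆Q zero             = zero
  Span-mono P⊆Q (add v∈ w∈)      = add (Span-mono P⊆Q v∈) (Span-mono P⊆Q w∈)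
  Span-mono P⊆Q (scale s v∈)     = scale s (Span-mono P⊆Q v∈)
  Span-mono P⊆Q (respects v≈ v∈) = respects v≈ (Span-mono P⊆Q v∈)

  Span-split : ∀ {P Q b v} → (∀ {p} → p ∈ P → p ∈ Q ⊎ p ≡ b) → v ∈ Span P →
               ∃₂ λ s z → z ∈ Span Q × v ≈ᴹ s *ₗ b +ᴹ z
  Span-split {b = b} {v} split (generator v∈P) with split v∈P
  ... | inj₁ v∈Q    = 0# , v , generator v∈Q ,
    solveᴹ [] (v ∷ b ∷ []) (λ v b → v ⊜ con (+ 0) ⊙ b ⊕ v) ≡.refl
  ... | inj₂ ≡.refl = 1# , 0ᴹ , zero , solveᴹ [] (b ∷ []) (λ b → b ⊜ con (+ 1) ⊙ b ⊕ 𝟎) ≡.refl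
  Span-split {b = b} split zero = 0# , 0ᴹ , zero ,
    solveᴹ [] (b ∷ []) (λ b → 𝟎 ⊜ con (+ 0) ⊙ b ⊕ 𝟎) ≡.refl
  Span-split {b = b} split (add v∈ w∈)
    with s , y , y∈ , v≈ ← Span-split split v∈ | t , z , z∈ , w≈ ← Span-split split w∈ =
    s + t , y +ᴹ z , add y∈ z∈ , ≈ᴹ-trans (+ᴹ-cong v≈ w≈)
      (solveᴹ (s ∷ t ∷ []) (b ∷ y ∷ z ∷ [])
        (λ s t b y z → (s ⊙ b ⊕ y) ⊕ (t ⊙ b ⊕ z) ⊜ (s :+ t) ⊙ b ⊕ (y ⊕ z)) ≡.refl)
  Span-split {b = b} split (scale r v∈) with s , y , y∈ , v≈ ← Span-split split v∈ =
    r * s , r *ₗ y , scale r y∈ , ≈ᴹ-trans (*ₗ-congˡ v≈)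
      (solveᴹ (r ∷ s ∷ []) (b ∷ y ∷ [])
        (λ r s b y → r ⊙ (s ⊙ b ⊕ y) ⊜ (r :* s) ⊙ b ⊕ r ⊙ y) ≡.refl)
  Span-split split (respects v≈w v∈) with s , y , y∈ , v≈ ← Span-split split v∈ =
    s , y , y∈ , ≈ᴹ-trans (≈ᴹ-sym v≈w) v≈

  -- Greedy choice keeps each term out of the span of the earlier ones; by exchange it is then
  -- outside the span of all the others. That span, taken at every height, is the separating cone.
  -- It is exhausted by its parts with indices below `N`, which allows induction on `N`.
  independentSequence⇒infiniteIndependent : ∀ X →
    (∀ bs → ∃[ x ] (x ∈ mem X × ¬ x ∈ Span (_∈ₗ bs))) → HasInfiniteConvexlyIndependentSubset X
  independentSequence⇒infiniteIndependent X extend =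
    separated⇒infiniteIndependent X x (λ n → proj₁ (sequence-extends n))
      (λ j _ v → ∃[ N ] v ∈ Span (others j N)) span-cone inside
      (λ { j (N , xj∈) → x∉Span j N xj∈ })
    where
    open GreedySequence extend using (history; sequence-extends; sequence∈history)
      renaming (sequence to x)
    open ≈ᴹ-Reasoning

    others : ℕ → ℕ → Pred Carrierᴹ ℓ
    others j N v = ∃[ i ] (i <ₙ N × i ≢ j × v ≡ x i)

    others⊆history : ∀ {j N n} → N ≤ₙ n → others j N ⊆ (_∈ₗ history n)
    others⊆history N≤n (i , i<N , _ , ≡.refl) = sequence∈history (ℕ.<-≤-trans i<N N≤n)

    others-mono : ∀ {j M N} → M ≤ₙ N → others j M ⊆ others j N
    others-mono M≤N (i , i<M , i≢j , v≡xi) = i , ℕ.<-≤-trans i<M M≤N , i≢j , v≡xi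

    others-suc : ∀ {j N p} → p ∈ others j (suc N) → p ∈ others j N ⊎ p ≡ x N
    others-suc (i , s≤s i≤N , i≢j , ≡.refl) with ℕ.m≤n⇒m<n∨m≡n i≤N
    ... | inj₁ i<N    = inj₁ (i , i<N , i≢j , ≡.refl)
    ... | inj₂ ≡.refl = inj₂ ≡.refl

    span-cone : ∀ j → IsCone (λ _ v → ∃[ N ] v ∈ Span (others j N))
    span-cone j = record
      { respects = λ { _ v≈w (N , v∈) → N , respects v≈w v∈ }
      ; origin   = 0 , zero
      ; add      = λ { (M , v∈) (N , w∈) → M ℕ.⊔ N ,
          add (Span-mono (others-mono (ℕ.m≤m⊔n M N)) v∈) (Span-mono (others-mono (ℕ.m≤n⊔m M N)) w∈) }
      ; scale    = λ { {s} _ (N , v∈) → N , scale s v∈ }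
      }

    inside : ∀ {j n} → n ≢ j → ∃[ N ] x n ∈ Span (others j N)
    inside {n = n} n≢j = suc n , generator (n , ℕ.n<1+n n , n≢j , ≡.refl)

    x∉history : ∀ {j N} → N ≤ₙ j → ¬ x j ∈ Span (others j N)
    x∉history {j} N≤j xj∈ =
      proj₂ (sequence-extends j) (Span-mono (others⊆history N≤j) xj∈)

    x∉Span : ∀ j N → ¬ x j ∈ Span (others j N)
    x∉Span j zero    xj∈ = x∉history z≤n xj∈
    x∉Span j (suc N) xj∈ with ℕ.<-cmp N j
    ... | tri< N<j _ _ = x∉history N<j xj∈
    ... | tri≈ _ ≡.refl _ = x∉Span j N (Span-mono drop xj∈)
      where
      drop : others j (suc j) ⊆ others j j
      drop (i , s≤s i≤j , i≢j , v≡xi) = i , ℕ.≤∧≢⇒< i≤j i≢j , i≢j , v≡xi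
    ... | tri> _ _ j<N with s , z , z∈ , xj≈ ← Span-split {Q = others j N} {b = x N} others-suc xj∈ =
      case em {P = s ≈ 0#} of λ
        { (yes s≈0) → x∉Span j N (respects (≈ᴹ-sym (≈ᴹ-trans xj≈ (s*xN+z≈z s≈0))) z∈)
        ; (no s≉0)  → exchange (inverse s s≉0)
        }
      where
      s*xN+z≈z : s ≈ 0# → s *ₗ x N +ᴹ z ≈ᴹ z
      s*xN+z≈z s≈0 = ≈ᴹ-trans (+ᴹ-congʳ (*ₗ-congʳ s≈0))
        (≈ᴹ-trans (+ᴹ-congʳ (*ₗ-zeroˡ (x N))) (+ᴹ-identityˡ z))
      -- If `x N` enters `x j` with an invertible coefficient, solving for `x N` expresses it by
      -- `x j` and other terms before `N`, against its greedy choice.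
      exchange : ¬ (∃[ t ] s * t ≈ 1#)
      exchange (t , st≈1) = proj₂ (sequence-extends N)
        (respects xN≈ (add (scale t (generator (sequence∈history j<N)))
          (scale (- t) (Span-mono (others⊆history ℕ.≤-refl) z∈))))
        where
        xN≈ : t *ₗ x j +ᴹ (- t) *ₗ z ≈ᴹ x N
        xN≈ = begin
          t *ₗ x j +ᴹ (- t) *ₗ z              ≈⟨ +ᴹ-congʳ (*ₗ-congˡ xj≈) ⟩
          t *ₗ (s *ₗ x N +ᴹ z) +ᴹ (- t) *ₗ z  ≈⟨ solveᴹ (s ∷ t ∷ []) (x N ∷ z ∷ [])
            (λ s t x z → t ⊙ (s ⊙ x ⊕ z) ⊕ (:- t) ⊙ z ⊜ (s :* t) ⊙ x) ≡.refl ⟩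
          (s * t) *ₗ x N                      ≈⟨ *ₗ-congʳ st≈1 ⟩
          1# *ₗ x N                           ≈⟨ *ₗ-identityˡ (x N) ⟩
          x N                                 ∎

  -- Covers by flats modulo a subspace

  -- Flats and planes are taken modulo the span of bs.
  Flat : Carrierᴹ × Carrierᴹ → List Carrierᴹ → Pred Carrierᴹ ℓ
  Flat (p , u) bs x = ∃₂ λ r z → z ∈ Span (_∈ₗ bs) × x ≈ᴹ p +ᴹ (r *ₗ u +ᴹ z)

  Plane : Carrierᴹ → Carrierᴹ → Carrierᴹ → List Carrierᴹ → Pred Carrierᴹ ℓ
  Plane p u w bs x = ∃₂ λ s t → ∃[ z ] (z ∈ Span (_∈ₗ bs) × x ≈ᴹ p +ᴹ (s *ₗ u +ᴹ (t *ₗ w +ᴹ z)))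

  InFinitelyManyFlats : List Carrierᴹ → Pred Carrierᴹ ℓ → Set ℓ
  InFinitelyManyFlats bs X =
    Σ[ fs ∈ List (Carrierᴹ × Carrierᴹ) ] (∀ {x} → x ∈ X → Any (λ f → Flat f bs x) fs)

  Flat-∷⇒Plane : ∀ {p u w bs x} → Flat (p , u) (w ∷ bs) x → Plane p u w bs x
  Flat-∷⇒Plane {w = w} {bs} (r , z , z∈ , x≈)
    with t , y , y∈ , z≈ ← Span-split {Q = _∈ₗ bs} {b = w}
           (λ { (here p≡w) → inj₂ p≡w ; (there p∈bs) → inj₁ p∈bs }) z∈ =
    r , t , y , y∈ , ≈ᴹ-trans x≈ (+ᴹ-congˡ (+ᴹ-congˡ z≈))

  Plane-swap : ∀ {p u w bs} → Plane p u w bs ⊆ Plane p w u bs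
  Plane-swap {p} {u} {w} (s , t , z , z∈ , x≈) = t , s , z , z∈ , ≈ᴹ-trans x≈
    (solveᴹ (s ∷ t ∷ []) (p ∷ u ∷ w ∷ z ∷ [])
      (λ s t p u w z → p ⊕ (s ⊙ u ⊕ (t ⊙ w ⊕ z)) ⊜ p ⊕ (t ⊙ w ⊕ (s ⊙ u ⊕ z))) ≡.refl)

  -- A flat modulo `w ∷ bs` lies in a plane modulo `bs`. If each plane section of `X` had a finite
  -- cover by flats, concatenating those over `fs` would cover `X`.
  criticalPlane : ∀ {w bs} X → ¬ InFinitelyManyFlats bs X → InFinitelyManyFlats (w ∷ bs) X →
                  ∃₂ λ p u → ¬ InFinitelyManyFlats bs (X ∩ Plane p u w bs)
  criticalPlane {w} {bs} X ¬flats (fs , covers) = decidable-stable em λ none →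
    let flats : ∀ f → InFinitelyManyFlats bs (X ∩ Plane (proj₁ f) (proj₂ f) w bs)
        flats (p , u) = decidable-stable em λ ¬flats → none (p , u , ¬flats)
    in ¬flats (concatMap (λ f → proj₁ (flats f)) fs , λ x∈X → Any.concatMap⁺ _
         (Any.map (λ {f} x∈f → proj₂ (flats f) (x∈X , Flat-∷⇒Plane x∈f)) (covers x∈X)))

  -- Since `a` is invertible, the relation lets `s *ₗ u` be replaced by `s * a⁻¹` times `z - b w`:
  -- the direction `u` disappears and the plane collapses to one flat.
  dependent⇒flat : ∀ {p u w bs a b z} → ¬ a ≈ 0# → z ∈ Span (_∈ₗ bs) →
                   a *ₗ u +ᴹ b *ₗ w ≈ᴹ z → Plane p u w bs ⊆ Flat (p , w) bs
  dependent⇒flat {p} {u} {w} {a = a} {b} {z} a≉0 z∈ au+bw≈z {x} (s , t , y , y∈ , x≈)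
    with a⁻¹ , aa⁻¹≈1 ← inverse a a≉0 =
    t - s * a⁻¹ * b , y +ᴹ (s * a⁻¹) *ₗ z , add y∈ (scale _ z∈) , (begin
      x                                              ≈⟨ x≈ ⟩
      p +ᴹ (s *ₗ u +ᴹ (t *ₗ w +ᴹ y))
        ≈⟨ +ᴹ-congˡ (+ᴹ-congʳ (*ₗ-congʳ (trans (*-congˡ aa⁻¹≈1) (*-identityʳ s)))) ⟨
      p +ᴹ ((s * (a * a⁻¹)) *ₗ u +ᴹ (t *ₗ w +ᴹ y))
        ≈⟨ solveᴹ (a ∷ b ∷ a⁻¹ ∷ s ∷ t ∷ []) (p ∷ u ∷ w ∷ y ∷ [])
             (λ a b a⁻¹ s t p u w y → p ⊕ ((s :* (a :* a⁻¹)) ⊙ u ⊕ (t ⊙ w ⊕ y))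
               ⊜ p ⊕ ((t :- s :* a⁻¹ :* b) ⊙ w ⊕ (y ⊕ (s :* a⁻¹) ⊙ (a ⊙ u ⊕ b ⊙ w)))) ≡.refl ⟩
      p +ᴹ ((t - s * a⁻¹ * b) *ₗ w +ᴹ (y +ᴹ (s * a⁻¹) *ₗ (a *ₗ u +ᴹ b *ₗ w)))
        ≈⟨ +ᴹ-congˡ (+ᴹ-congˡ (+ᴹ-congˡ (*ₗ-congˡ au+bw≈z))) ⟩
      p +ᴹ ((t - s * a⁻¹ * b) *ₗ w +ᴹ (y +ᴹ (s * a⁻¹) *ₗ z)) ∎)
    where open ≈ᴹ-Reasoning

  -- A nonzero coefficient in such a relation would collapse the plane to a single flat, contrary to
  -- the assumption; for `b` the roles of `u` and `w` are exchanged.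
  independent : ∀ {p u w bs} (X : Pred Carrierᴹ ℓ) → ¬ InFinitelyManyFlats bs (X ∩ Plane p u w bs) →
                ∀ {a b z} → z ∈ Span (_∈ₗ bs) → a *ₗ u +ᴹ b *ₗ w ≈ᴹ z → a ≈ 0# × b ≈ 0#
  independent X ¬flats z∈ au+bw≈z =
    decidable-stable em (λ a≉0 → ¬flats (_ ∷ [] , λ { (_ , x∈) →
      here (dependent⇒flat a≉0 z∈ au+bw≈z x∈) })) ,
    decidable-stable em (λ b≉0 → ¬flats (_ ∷ [] , λ { (_ , x∈) →
      here (dependent⇒flat b≉0 z∈ (≈ᴹ-trans (+ᴹ-comm _ _) au+bw≈z) (Plane-swap x∈)) }))

  -- Orientation in the coordinate plane

  -- A linear functional on homogeneous coordinates, height first; at height 1 it is an affine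
  -- function on the plane.
  ⟪_,_⟫ : Carrier × Carrier × Carrier → Carrier × Carrier × Carrier → Carrier
  ⟪ (d , e , f) , (a , b , c) ⟫ = a * d + b * e + c * f

  ⟪⟫-zero : ∀ d → ⟪ d , (0# , 0# , 0#) ⟫ ≈ 0#
  ⟪⟫-zero (d , e , f) = solve 3
    (λ d e f → con (+ 0) :* d :+ con (+ 0) :* e :+ con (+ 0) :* f := con (+ 0)) refl d e f

  ⟪⟫-+ : ∀ d {a b c a′ b′ c′} →
         ⟪ d , (a , b , c) ⟫ + ⟪ d , (a′ , b′ , c′) ⟫ ≈ ⟪ d , (a + a′ , b + b′ , c + c′) ⟫
  ⟪⟫-+ (d , e , f) {a} {b} {c} {a′} {b′} {c′} = solve 9 (λ d e f a b c a′ b′ c′ →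
    a :* d :+ b :* e :+ c :* f :+ (a′ :* d :+ b′ :* e :+ c′ :* f) :=
    (a :+ a′) :* d :+ (b :+ b′) :* e :+ (c :+ c′) :* f) refl d e f a b c a′ b′ c′

  ⟪⟫-* : ∀ d s {a b c} → s * ⟪ d , (a , b , c) ⟫ ≈ ⟪ d , (s * a , s * b , s * c) ⟫
  ⟪⟫-* (d , e , f) s {a} {b} {c} = solve 7 (λ d e f s a b c →
    s :* (a :* d :+ b :* e :+ c :* f) :=
    s :* a :* d :+ s :* b :* e :+ s :* c :* f) refl d e f s a b c

  *-⟪⟫ : ∀ s d {c} → s * ⟪ d , c ⟫ ≈ ⟪ (s * proj₁ d , s * proj₁ (proj₂ d) , s * proj₂ (proj₂ d)) , c ⟫
  *-⟪⟫ s (d , e , f) {a , b , c} = solve 7 (λ d e f s a b c →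
    s :* (a :* d :+ b :* e :+ c :* f) :=
    a :* (s :* d) :+ b :* (s :* e) :+ c :* (s :* f)) refl d e f s a b c

  ⟪⟫-cong : ∀ d {a b c a′ b′ c′} → a ≈ a′ → b ≈ b′ → c ≈ c′ →
            ⟪ d , (a , b , c) ⟫ ≈ ⟪ d , (a′ , b′ , c′) ⟫
  ⟪⟫-cong d a≈a′ b≈b′ c≈c′ = +-cong (+-cong (*-congʳ a≈a′) (*-congʳ b≈b′)) (*-congʳ c≈c′)

  -- Homogeneous coordinates of the line through two points of the plane.
  join : Carrier × Carrier → Carrier × Carrier → Carrier × Carrier × Carrier
  join (a₁ , a₂) (b₁ , b₂) = a₁ * b₂ - a₂ * b₁ , a₂ - b₂ , b₁ - a₁

  -- The determinant with rows (1, a), (1, b), (1, c), that is, twice the signed area of the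
  -- triangle.
  orientation : Carrier × Carrier → Carrier × Carrier → Carrier × Carrier → Carrier
  orientation a b c = ⟪ join a b , (1# , c) ⟫

  -- For equal points the line degenerates to that point, so avoiding the lines through all pairs
  -- from a list, repetitions included, also means avoiding its points.
  OnLine : Carrier × Carrier → Carrier × Carrier → Carrier × Carrier → Set ℓ
  OnLine (a₁ , a₂) (b₁ , b₂) (c₁ , c₂) =
    ∃[ r ] (c₁ ≈ a₁ + r * (b₁ - a₁) × c₂ ≈ a₂ + r * (b₂ - a₂))

  orientation-cycle : ∀ a b c → orientation a b c ≈ orientation b c a
  orientation-cycle (a₁ , a₂) (b₁ , b₂) (c₁ , c₂) = solve 6
    (λ a₁ a₂ b₁ b₂ c₁ c₂ →
      con (+ 1) :* (a₁ :* b₂ :- a₂ :* b₁) :+ c₁ :* (a₂ :- b₂) :+ c₂ :* (b₁ :- a₁) :=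
      con (+ 1) :* (b₁ :* c₂ :- b₂ :* c₁) :+ a₁ :* (b₂ :- c₂) :+ a₂ :* (c₁ :- b₁))
    refl a₁ a₂ b₁ b₂ c₁ c₂

  orientation-swap : ∀ a b c → orientation a c b ≈ - orientation a b c
  orientation-swap (a₁ , a₂) (b₁ , b₂) (c₁ , c₂) = solve 6
    (λ a₁ a₂ b₁ b₂ c₁ c₂ →
      con (+ 1) :* (a₁ :* c₂ :- a₂ :* c₁) :+ b₁ :* (a₂ :- c₂) :+ b₂ :* (c₁ :- a₁) :=
      :- (con (+ 1) :* (a₁ :* b₂ :- a₂ :* b₁) :+ c₁ :* (a₂ :- b₂) :+ c₂ :* (b₁ :- a₁)))
    refl a₁ a₂ b₁ b₂ c₁ c₂

  orientation-aba : ∀ a b → orientation a b a ≈ 0#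
  orientation-aba (a₁ , a₂) (b₁ , b₂) = solve 4
    (λ a₁ a₂ b₁ b₂ →
      con (+ 1) :* (a₁ :* b₂ :- a₂ :* b₁) :+ a₁ :* (a₂ :- b₂) :+ a₂ :* (b₁ :- a₁) := con (+ 0))
    refl a₁ a₂ b₁ b₂

  orientation-abb : ∀ a b → orientation a b b ≈ 0#
  orientation-abb a b = trans (orientation-cycle a b b)
    (trans (orientation-cycle b b a) (orientation-aba b a))

  proportional : ∀ {d₁ d₂ e₁ e₂} → d₁ * e₂ ≈ d₂ * e₁ → ¬ d₁ ≈ 0# →
                 ∃[ r ] (e₁ ≈ r * d₁ × e₂ ≈ r * d₂)
  proportional {d₁} {d₂} {e₁} {e₂} cross d₁≉0 with d₁⁻¹ , inv ← inverse d₁ d₁≉0 =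
    d₁⁻¹ * e₁ ,
    (begin
      e₁                ≈⟨ *-identityˡ e₁ ⟨
      1# * e₁           ≈⟨ *-congʳ inv ⟨
      d₁ * d₁⁻¹ * e₁    ≈⟨ solve 3 (λ d i e → d :* i :* e := i :* e :* d) refl d₁ d₁⁻¹ e₁ ⟩
      d₁⁻¹ * e₁ * d₁    ∎) ,
    (begin
      e₂                ≈⟨ *-identityˡ e₂ ⟨
      1# * e₂           ≈⟨ *-congʳ inv ⟨
      d₁ * d₁⁻¹ * e₂    ≈⟨ solve 3 (λ d i e → d :* i :* e := i :* (d :* e)) refl d₁ d₁⁻¹ e₂ ⟩
      d₁⁻¹ * (d₁ * e₂)  ≈⟨ *-congˡ cross ⟩
      d₁⁻¹ * (d₂ * e₁)  ≈⟨ solve 3 (λ d i e → i :* (d :* e) := i :* e :* d) refl d₂ d₁⁻¹ e₁ ⟩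
      d₁⁻¹ * e₁ * d₂    ∎)
    where open ≈-Reasoning

  x-y≈z⇒x≈y+z : ∀ {x y z} → x - y ≈ z → x ≈ y + z
  x-y≈z⇒x≈y+z {x} {y} eq = trans (solve 2 (λ x y → x := y :+ (x :- y)) refl x y) (+-congˡ eq)

  collinear⇒cross : ∀ {a₁ a₂ b₁ b₂ c₁ c₂} → orientation (a₁ , a₂) (b₁ , b₂) (c₁ , c₂) ≈ 0# →
                    (b₁ - a₁) * (c₂ - a₂) ≈ (b₂ - a₂) * (c₁ - a₁)
  collinear⇒cross {a₁} {a₂} {b₁} {b₂} {c₁} {c₂} Δ≈0 = trans
    (solve 6
      (λ a₁ a₂ b₁ b₂ c₁ c₂ → (b₁ :- a₁) :* (c₂ :- a₂) :=
        (con (+ 1) :* (a₁ :* b₂ :- a₂ :* b₁) :+ c₁ :* (a₂ :- b₂) :+ c₂ :* (b₁ :- a₁))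
          :+ (b₂ :- a₂) :* (c₁ :- a₁)) refl a₁ a₂ b₁ b₂ c₁ c₂)
    (trans (+-congʳ Δ≈0) (+-identityˡ _))

  -- Vanishing orientation makes `b - a` and `c - a` parallel; the parameter is found by dividing by
  -- a nonzero coordinate of `b - a`, which exists because the points differ.
  collinear⇒OnLine : ∀ {a b c} → orientation a b c ≈ 0# → ¬ OnLine a a b → OnLine a b c
  collinear⇒OnLine {a₁ , a₂} {b₁ , b₂} {c₁ , c₂} Δ≈0 b≉a
    with em {P = b₁ - a₁ ≈ 0#} | em {P = b₂ - a₂ ≈ 0#}
  ... | no d₁≉0 | _ =
    let r , e₁≈ , e₂≈ = proportional (collinear⇒cross Δ≈0) d₁≉0
    in r , x-y≈z⇒x≈y+z e₁≈ , x-y≈z⇒x≈y+z e₂≈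
  ... | yes _ | no d₂≉0 =
    let r , e₂≈ , e₁≈ = proportional (sym (collinear⇒cross Δ≈0)) d₂≉0
    in r , x-y≈z⇒x≈y+z e₁≈ , x-y≈z⇒x≈y+z e₂≈
  ... | yes d₁≈0 | yes d₂≈0 = contradiction (0# , b≈a d₁≈0 , b≈a d₂≈0) b≉a
    where
    b≈a : ∀ {x y} → y - x ≈ 0# → y ≈ x + 0# * (x - x)
    b≈a eq = trans (x-y≈z⇒x≈y+z eq) (+-congˡ (sym (zeroˡ _)))

  -- Triples of constant orientation

  unit : Bool → Carrier
  unit true  = 1#
  unit false = - 1#

  unit-* : ∀ {x b} (0≤x? : Dec (0# ≤ x)) → does 0≤x? ≡ b → ¬ x ≈ 0# →
           0# ≤ unit b * x × ¬ unit b * x ≈ 0#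
  unit-* {x} (yes 0≤x) ≡.refl x≉0 =
    O.≤-respʳ-≈ (sym (*-identityˡ x)) 0≤x , λ eq → x≉0 (trans (sym (*-identityˡ x)) eq)
  unit-* {x} (no x≱0) ≡.refl x≉0 =
    O.≤-respʳ-≈ (sym (-1*x≈-x x))
      (x≤0⇒0≤-x ([ (λ 0≤x → contradiction 0≤x x≱0) , id ]′ (O.total 0# x))) ,
    λ eq → x≉0 (trans (sym (-‿involutive x)) (trans (-‿cong (trans (sym (-1*x≈-x x)) eq)) -0#≈0#))

  Signed : Carrier → (ℕ → ℕ → ℕ → Carrier) → Set ℓ
  Signed σ Δ = ∀ {i j k} → i <ₙ j → j <ₙ k → 0# ≤ σ * Δ i j k × ¬ σ * Δ i j k ≈ 0#

  -- Ramsey's theorem for the colouring that asks whether the value is nonnegative. As no value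
  -- vanishes, the common sign is strict after multiplication by `unit b`.
  equisigned : (Δ : ℕ → ℕ → ℕ → Carrier) → (∀ {i j k} → i <ₙ j → j <ₙ k → ¬ Δ i j k ≈ 0#) →
    ∃[ b ] Σ[ h ∈ (ℕ → ℕ) ] Signed (unit b) (λ i j k → Δ (h i) (h j) (h k))
  equisigned Δ Δ≉0 =
    let b , h , h↑ , monochromatic = ramsey-triples (λ i j k → does (em {P = 0# ≤ Δ i j k}))
    in b , h , λ {i} {j} {k} i<j j<k →
         unit-* {Δ (h i) (h j) (h k)} em (monochromatic i<j j<k) (Δ≉0 (h↑ i<j) (h↑ j<k))

  module _ (σ : Carrier) (c : ℕ → Carrier × Carrier)
           (signed : Signed σ (λ i j k → orientation (c i) (c j) (c k))) where

    private
      j<2+j : ∀ j → j <ₙ suc (suc j)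
      j<2+j j = ℕ.<-trans (ℕ.n<1+n j) (ℕ.n<1+n (suc j))

      vanishes : ∀ {x} → x ≈ 0# → 0# ≤ σ * x
      vanishes x≈0 = O.reflexive (sym (trans (*-congˡ x≈0) (zeroʳ σ)))

    -- The points `j` and `2 + j` are the neighbours of `1 + j`. A further point before `j` comes
    -- into increasing position by a cyclic shift, one after `2 + j` is there already, and the
    -- neighbours themselves lie on the line.
    neighbours-separate : ∀ {j n} → n ≢ j →
      0# ≤ σ * orientation (c j) (c (suc (suc j))) (c (suc n))
    neighbours-separate {j} {n} n≢j = [ before , after ]′ (ℕ.≤-<-connex n j)
      where
      before : n ≤ₙ j → 0# ≤ σ * orientation (c j) (c (suc (suc j))) (c (suc n))
      before n≤j = [
        (λ 1+n<j → O.≤-respʳ-≈ (*-congˡ (orientation-cycle (c (suc n)) (c j) (c (suc (suc j)))))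
          (proj₁ (signed 1+n<j (j<2+j j)))) ,
        (λ { ≡.refl → vanishes (orientation-aba (c (suc n)) (c (suc (suc (suc n))))) }) ]′
        (ℕ.m≤n⇒m<n∨m≡n (ℕ.≤∧≢⇒< n≤j n≢j))
      after : j <ₙ n → 0# ≤ σ * orientation (c j) (c (suc (suc j))) (c (suc n))
      after j<n = [
        (λ 1+j<n → proj₁ (signed (j<2+j j) (s≤s 1+j<n))) ,
        (λ { ≡.refl → vanishes (orientation-abb (c j) (c (suc (suc j)))) }) ]′
        (ℕ.m≤n⇒m<n∨m≡n j<n)

    -- Here the indices form an odd permutation of an increasing triple, so the sign is strictly
    -- opposite.
    neighbours-strict : ∀ j → ¬ 0# ≤ σ * orientation (c j) (c (suc (suc j))) (c (suc j))
    neighbours-strict j 0≤ = proj₂ Δ-signed (O.antisym (0≤-x⇒x≤0 (O.≤-respʳ-≈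
        (trans (*-congˡ (orientation-swap (c j) (c (suc j)) (c (suc (suc j)))))
          (sym (-‿distribʳ-* σ (orientation (c j) (c (suc j)) (c (suc (suc j)))))))
        0≤)) (proj₁ Δ-signed))
      where
      Δ-signed = signed (ℕ.n<1+n j) (ℕ.n<1+n (suc j))

  separatedSubsequence : (c : ℕ → Carrier × Carrier) →
    (∀ {i j k} → i <ₙ j → j <ₙ k → ¬ orientation (c i) (c j) (c k) ≈ 0#) →
    Σ[ h ∈ (ℕ → ℕ) ] Σ[ φ ∈ (ℕ → Carrier × Carrier × Carrier) ]
      ((∀ {j n} → n ≢ j → 0# ≤ ⟪ φ j , (1# , c (h n)) ⟫) ×
       (∀ j → ¬ 0# ≤ ⟪ φ j , (1# , c (h j)) ⟫))
  separatedSubsequence c noncollinear =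
    let b , h , signed = equisigned (λ i j k → orientation (c i) (c j) (c k)) noncollinear
        neighbours = λ j → join (c (h j)) (c (h (suc (suc j))))
    -- The shift omits the first point, which has no predecessor to serve as a neighbour.
    in h ∘ suc ,
       (λ j → unit b * proj₁ (neighbours j) , unit b * proj₁ (proj₂ (neighbours j)) ,
              unit b * proj₂ (proj₂ (neighbours j))) ,
       (λ {j} {n} n≢j → O.≤-respʳ-≈ (*-⟪⟫ (unit b) (neighbours j) {1# , c (h (suc n))})
         (neighbours-separate (unit b) (c ∘ h) signed n≢j)) ,
       λ j 0≤ → neighbours-strict (unit b) (c ∘ h) signed j
         (O.≤-respʳ-≈ (sym (*-⟪⟫ (unit b) (neighbours j) {1# , c (h (suc j))})) 0≤)

  -- Plane sections without a finite cover by flats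

  -- Coordinates are carried along with the point, so that the greedy choice can refer to them;
  -- `coordinates-unique` shows that the point determines them.
  record PlanePoint (X : Subset) (p u w : Carrierᴹ) (bs : List Carrierᴹ) : Set ℓ where
    field
      point       : Carrierᴹ
      point∈X     : point ∈ mem X
      coordinates : Carrier × Carrier
      offset      : Carrierᴹ
      offset∈     : offset ∈ Span (_∈ₗ bs)
      point≈      : point ≈ᴹ p +ᴹ (proj₁ coordinates *ₗ u +ᴹ (proj₂ coordinates *ₗ w +ᴹ offset))

  criticalPlane⇒infiniteIndependent : ∀ {p u w bs} X →
    ¬ InFinitelyManyFlats bs (mem X ∩ Plane p u w bs) → HasInfiniteConvexlyIndependentSubset X
  criticalPlane⇒infiniteIndependent {p} {u} {w} {bs} X ¬flats =
    separated⇒infiniteIndependent X (λ n → point (y n)) (λ n → point∈X (y n)) HalfPlane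
      halfPlane-cone inside outside
    where
    Pt = PlanePoint X p u w bs
    open PlanePoint

    Collinear : Pt → Pt → Pt → Set ℓ
    Collinear a b c = OnLine (coordinates a) (coordinates b) (coordinates c)

    flatThrough : Pt → Pt → Carrierᴹ × Carrierᴹ
    flatThrough a b = p +ᴹ (a₁ *ₗ u +ᴹ a₂ *ₗ w) , (b₁ - a₁) *ₗ u +ᴹ (b₂ - a₂) *ₗ w
      where
      a₁ = proj₁ (coordinates a)
      a₂ = proj₂ (coordinates a)
      b₁ = proj₁ (coordinates b)
      b₂ = proj₂ (coordinates b)

    collinear⇒flat : ∀ {a b c} → Collinear a b c → Flat (flatThrough a b) bs (point c)
    collinear⇒flat {a} {b} {c} (r , c₁≈ , c₂≈) = r , offset c , offset∈ c , (begin
      point c                                          ≈⟨ point≈ c ⟩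
      p +ᴹ (c₁ *ₗ u +ᴹ (c₂ *ₗ w +ᴹ offset c))
        ≈⟨ +ᴹ-congˡ (+ᴹ-cong (*ₗ-congʳ c₁≈) (+ᴹ-congʳ (*ₗ-congʳ c₂≈))) ⟩
      p +ᴹ ((a₁ + r * (b₁ - a₁)) *ₗ u +ᴹ ((a₂ + r * (b₂ - a₂)) *ₗ w +ᴹ offset c))
        ≈⟨ solveᴹ (a₁ ∷ a₂ ∷ b₁ ∷ b₂ ∷ r ∷ []) (p ∷ u ∷ w ∷ offset c ∷ [])
          (λ a₁ a₂ b₁ b₂ r p u w z →
            p ⊕ ((a₁ :+ r :* (b₁ :- a₁)) ⊙ u ⊕ ((a₂ :+ r :* (b₂ :- a₂)) ⊙ w ⊕ z)) ⊜
            (p ⊕ (a₁ ⊙ u ⊕ a₂ ⊙ w)) ⊕ (r ⊙ ((b₁ :- a₁) ⊙ u ⊕ (b₂ :- a₂) ⊙ w) ⊕ z)) ≡.refl ⟩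
      (p +ᴹ (a₁ *ₗ u +ᴹ a₂ *ₗ w)) +ᴹ (r *ₗ ((b₁ - a₁) *ₗ u +ᴹ (b₂ - a₂) *ₗ w) +ᴹ offset c) ∎)
      where
      open ≈ᴹ-Reasoning
      a₁ = proj₁ (coordinates a)
      a₂ = proj₂ (coordinates a)
      b₁ = proj₁ (coordinates b)
      b₂ = proj₂ (coordinates b)
      c₁ = proj₁ (coordinates c)
      c₂ = proj₂ (coordinates c)

    -- The flats through pairs of points of `l` are finitely many, so they miss some point of the
    -- section.
    extend : (l : List Pt) → ∃[ c ] (∀ {a b} → a ∈ₗ l → b ∈ₗ l → ¬ Collinear a b c)
    extend l = decidable-stable em λ none → ¬flats
      ( concatMap (λ a → List.map (flatThrough a) l) l
      , λ { (x∈X , s , t , z , z∈ , x≈) → decidable-stable em λ uncovered →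
          let c = record { point = _ ; point∈X = x∈X ; coordinates = s , t
                         ; offset = z ; offset∈ = z∈ ; point≈ = x≈ }
          in none (c , λ {a} {b} a∈l b∈l onLine → uncovered (Any.concatMap⁺ _
               (lose a∈l (Any.map⁺ (lose b∈l (collinear⇒flat {a} {b} {c} onLine)))))) } )

    open GreedySequence {P = λ l c → ∀ {a b} → a ∈ₗ l → b ∈ₗ l → ¬ Collinear a b c} extend
      using (sequence; sequence-extends; sequence∈history)

    noncollinear : ∀ {i j k} → i <ₙ j → j <ₙ k → ¬ orientation (coordinates (sequence i))
      (coordinates (sequence j)) (coordinates (sequence k)) ≈ 0#
    noncollinear {i} {j} {k} i<j j<k Δ≈0 =
      sequence-extends k (sequence∈history (ℕ.<-trans i<j j<k)) (sequence∈history j<k)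
        -- The pair formed by `i` twice yields that the points `i` and `j` differ.
        (collinear⇒OnLine Δ≈0 (sequence-extends j (sequence∈history i<j) (sequence∈history i<j)))

    separation = separatedSubsequence (λ n → coordinates (sequence n)) noncollinear

    y : ℕ → Pt
    y n = sequence (proj₁ separation n)

    φ : ℕ → Carrier × Carrier × Carrier
    φ = proj₁ (proj₂ separation)

    -- A half-plane of coordinates, lifted to a cone modulo the span of `bs`: letting `p` enter with
    -- the height `a` as its factor makes the affine condition homogeneous.
    HalfPlane : ℕ → Carrier → Pred Carrierᴹ ℓ
    HalfPlane j a v = ∃₂ λ b c → ∃[ z ]
      (z ∈ Span (_∈ₗ bs) × v ≈ᴹ a *ₗ p +ᴹ (b *ₗ u +ᴹ (c *ₗ w +ᴹ z)) × 0# ≤ ⟪ φ j , (a , b , c) ⟫)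

    halfPlane-cone : ∀ j → IsCone (HalfPlane j)
    halfPlane-cone j = record
      { respects = λ { a≈a′ v≈v′ (b , c , z , z∈ , v≈ , 0≤) → b , c , z , z∈ ,
          ≈ᴹ-trans (≈ᴹ-sym v≈v′) (≈ᴹ-trans v≈ (+ᴹ-congʳ (*ₗ-congʳ a≈a′))) ,
          O.≤-respʳ-≈ (⟪⟫-cong (φ j) a≈a′ refl refl) 0≤ }
      ; origin = 0# , 0# , 0ᴹ , zero ,
          solveᴹ [] (p ∷ u ∷ w ∷ [])
            (λ p u w → 𝟎 ⊜ con (+ 0) ⊙ p ⊕ (con (+ 0) ⊙ u ⊕ (con (+ 0) ⊙ w ⊕ 𝟎))) ≡.refl ,
          O.reflexive (sym (⟪⟫-zero (φ j)))
      ; add = λ { {a} {a′} (b , c , z , z∈ , v≈ , 0≤) (b′ , c′ , z′ , z′∈ , v′≈ , 0≤′) →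
          b + b′ , c + c′ , z +ᴹ z′ , add z∈ z′∈ ,
          ≈ᴹ-trans (+ᴹ-cong v≈ v′≈) (solveᴹ (a ∷ a′ ∷ b ∷ b′ ∷ c ∷ c′ ∷ []) (p ∷ u ∷ w ∷ z ∷ z′ ∷ [])
            (λ a a′ b b′ c c′ p u w z z′ →
              (a ⊙ p ⊕ (b ⊙ u ⊕ (c ⊙ w ⊕ z))) ⊕ (a′ ⊙ p ⊕ (b′ ⊙ u ⊕ (c′ ⊙ w ⊕ z′))) ⊜
              (a :+ a′) ⊙ p ⊕ ((b :+ b′) ⊙ u ⊕ ((c :+ c′) ⊙ w ⊕ (z ⊕ z′)))) ≡.refl) ,
          O.≤-respʳ-≈ (⟪⟫-+ (φ j)) (+-nonNeg 0≤ 0≤′) }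
      ; scale = λ { {s} {a} 0≤s (b , c , z , z∈ , v≈ , 0≤) →
          s * b , s * c , s *ₗ z , scale s z∈ ,
          ≈ᴹ-trans (*ₗ-congˡ v≈) (solveᴹ (s ∷ a ∷ b ∷ c ∷ []) (p ∷ u ∷ w ∷ z ∷ [])
            (λ s a b c p u w z → s ⊙ (a ⊙ p ⊕ (b ⊙ u ⊕ (c ⊙ w ⊕ z))) ⊜
              (s :* a) ⊙ p ⊕ ((s :* b) ⊙ u ⊕ ((s :* c) ⊙ w ⊕ s ⊙ z))) ≡.refl) ,
          O.≤-respʳ-≈ (⟪⟫-* (φ j) s) (*-nonNeg 0≤s 0≤) }
      }

    inside : ∀ {j n} → n ≢ j → HalfPlane j 1# (point (y n))
    inside {j} {n} n≢j = proj₁ (coordinates (y n)) , proj₂ (coordinates (y n)) ,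
      offset (y n) , offset∈ (y n) ,
      ≈ᴹ-trans (point≈ (y n)) (+ᴹ-congʳ (≈ᴹ-sym (*ₗ-identityˡ p))) ,
      proj₁ (proj₂ (proj₂ separation)) n≢j

    -- Subtracting two representations of one point leaves a combination of `u` and `w` in the span
    -- of `bs`, so both coefficients vanish. Refuting membership in `HalfPlane` relies on this,
    -- because the coordinates there are existentially quantified.
    coordinates-unique : ∀ (P : Pt) {b c z} → z ∈ Span (_∈ₗ bs) →
      point P ≈ᴹ 1# *ₗ p +ᴹ (b *ₗ u +ᴹ (c *ₗ w +ᴹ z)) →
      b ≈ proj₁ (coordinates P) × c ≈ proj₂ (coordinates P)
    coordinates-unique P {b} {c} {z} z∈ P≈ = x-y≈0⇒y≈x (proj₁ equal) , x-y≈0⇒y≈x (proj₂ equal)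
      where
      open ≈ᴹ-Reasoning
      s = proj₁ (coordinates P)
      t = proj₂ (coordinates P)
      z′ = offset P

      difference : (s - b) *ₗ u +ᴹ (t - c) *ₗ w ≈ᴹ z +ᴹ (- 1#) *ₗ z′
      difference = begin
        (s - b) *ₗ u +ᴹ (t - c) *ₗ w
          ≈⟨ solveᴹ (s ∷ t ∷ b ∷ c ∷ []) (p ∷ u ∷ w ∷ z ∷ z′ ∷ [])
            (λ s t b c p u w z z′ → (s :- b) ⊙ u ⊕ (t :- c) ⊙ w ⊜
              ((p ⊕ (s ⊙ u ⊕ (t ⊙ w ⊕ z′))) ⊕
                (:- con (+ 1)) ⊙ (con (+ 1) ⊙ p ⊕ (b ⊙ u ⊕ (c ⊙ w ⊕ z)))) ⊕
              (z ⊕ (:- con (+ 1)) ⊙ z′)) ≡.refl ⟩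
        ((p +ᴹ (s *ₗ u +ᴹ (t *ₗ w +ᴹ z′))) +ᴹ
          (- 1#) *ₗ (1# *ₗ p +ᴹ (b *ₗ u +ᴹ (c *ₗ w +ᴹ z)))) +ᴹ (z +ᴹ (- 1#) *ₗ z′)
          ≈⟨ +ᴹ-congʳ (+ᴹ-cong (point≈ P) (*ₗ-congˡ P≈)) ⟨
        (point P +ᴹ (- 1#) *ₗ point P) +ᴹ (z +ᴹ (- 1#) *ₗ z′)
          ≈⟨ solveᴹ [] (point P ∷ z ∷ z′ ∷ []) (λ x z z′ →
            (x ⊕ (:- con (+ 1)) ⊙ x) ⊕ (z ⊕ (:- con (+ 1)) ⊙ z′) ⊜ z ⊕ (:- con (+ 1)) ⊙ z′) ≡.refl ⟩
        z +ᴹ (- 1#) *ₗ z′ ∎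

      equal : s - b ≈ 0# × t - c ≈ 0#
      equal = independent (mem X) ¬flats (add z∈ (scale (- 1#) (offset∈ P))) difference

      x-y≈0⇒y≈x : ∀ {x y} → x - y ≈ 0# → y ≈ x
      x-y≈0⇒y≈x eq = sym (trans (x-y≈z⇒x≈y+z eq) (+-identityʳ _))

    outside : ∀ j → ¬ HalfPlane j 1# (point (y j))
    outside j (b , c , z , z∈ , yj≈ , 0≤) =
      let b≈ , c≈ = coordinates-unique (y j) z∈ yj≈
      in proj₂ (proj₂ (proj₂ separation)) j (O.≤-respʳ-≈ (⟪⟫-cong (φ j) refl b≈ c≈) 0≤)

  -- Covers by flats and covers by lines

  ¬flats⇒infiniteIndependent : ∀ X → ¬ InFinitelyManyFlats [] (mem X) →
                              HasInfiniteConvexlyIndependentSubset X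
  ¬flats⇒infiniteIndependent X ¬flats
    with em {P = ∃[ bs ] InFinitelyManyFlats bs (mem X)}
  ... | yes (bs , flats) = critical bs flats
    where
    -- Generators are removed one by one until the cover is lost, at the latest for the empty list.
    critical : ∀ bs → InFinitelyManyFlats bs (mem X) → HasInfiniteConvexlyIndependentSubset X
    critical []       flats = contradiction flats ¬flats
    critical (w ∷ bs) flats with em {P = InFinitelyManyFlats bs (mem X)}
    ... | yes flats′ = critical bs flats′
    ... | no  ¬flats′ =
      let p , u , ¬plane = criticalPlane (mem X) ¬flats′ flats
      in criticalPlane⇒infiniteIndependent X ¬plane
  ... | no none = independentSequence⇒infiniteIndependent X λ bs →
    -- If the span of `bs` contained `X`, the single flat with base point and direction 0 would
    -- cover `X`.
    decidable-stable em λ spanning → none (bs , (0ᴹ , 0ᴹ) ∷ [] , λ {x} x∈X →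
      here (0# , x , decidable-stable em (λ x∉ → spanning (x , x∈X , x∉)) ,
        solveᴹ [] (x ∷ []) (λ x → x ⊜ 𝟎 ⊕ (con (+ 0) ⊙ 𝟎 ⊕ x)) ≡.refl))

  -- A flat with zero direction is a point and is placed on the line through it in the direction of
  -- the nonzero vector `v`.
  flats⇒lines : Nontrivial → ∀ X → InFinitelyManyFlats [] (mem X) → InFiniteUnionOfLines X
  flats⇒lines (v , v≉0) X (fs , covers) =
    length fs , (λ i → line (List.lookup fs i)) , λ x∈X →
      Any.index (covers x∈X) , Flat⊆line (List.lookup fs _) (Any.lookup-index (covers x∈X))
    where
    line : Carrierᴹ × Carrierᴹ → Line
    line (p , u) with em {P = u ≈ᴹ 0ᴹ}
    ... | yes _  = record { base = p ; direction = v ; direction≉0 = v≉0 }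
    ... | no u≉0 = record { base = p ; direction = u ; direction≉0 = u≉0 }

    Span-[] : ∀ {z} → z ∈ Span (_∈ₗ []) → z ≈ᴹ 0ᴹ
    Span-[] zero             = ≈ᴹ-refl
    Span-[] (add y∈ z∈)      = ≈ᴹ-trans (+ᴹ-cong (Span-[] y∈) (Span-[] z∈)) (+ᴹ-identityˡ 0ᴹ)
    Span-[] (scale s z∈)     = ≈ᴹ-trans (*ₗ-congˡ (Span-[] z∈)) (*ₗ-zeroʳ s)
    Span-[] (respects y≈ y∈) = ≈ᴹ-trans (≈ᴹ-sym y≈) (Span-[] y∈)

    Flat⊆line : ∀ f → Flat f [] ⊆ points (line f)
    Flat⊆line (p , u) (r , z , z∈ , x≈) with em {P = u ≈ᴹ 0ᴹ}
    ... | yes u≈0 = 0# , ≈ᴹ-trans x≈ (+ᴹ-congˡ (≈ᴹ-trans (+ᴹ-cong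
      (≈ᴹ-trans (*ₗ-congˡ u≈0) (*ₗ-zeroʳ r)) (Span-[] z∈))
      (≈ᴹ-trans (+ᴹ-identityˡ 0ᴹ) (≈ᴹ-sym (*ₗ-zeroˡ v)))))
    ... | no _    = r , ≈ᴹ-trans x≈ (+ᴹ-congˡ (≈ᴹ-trans (+ᴹ-congˡ (Span-[] z∈)) (+ᴹ-identityʳ _)))

  noInfiniteIndependent⇒lines : Nontrivial → ∀ X → ¬ HasInfiniteConvexlyIndependentSubset X →
                                InFiniteUnionOfLines X
  noInfiniteIndependent⇒lines nontrivial X ¬indep = flats⇒lines nontrivial X
    (decidable-stable em (¬indep ∘ ¬flats⇒infiniteIndependent X))

  -- Order dimension of sets on finitely many lines

  -- The weights are (b - t)/(b - a) and (t - a)/(b - a); when `a` and `b` agree, all three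
  -- parameters coincide.
  Line-between : ∀ (C : Subset) → Convex C → ∀ L {a t b} → let open Line L in
    base +ᴹ a *ₗ direction ∈ mem C → base +ᴹ b *ₗ direction ∈ mem C →
    a ≤ t → t ≤ b → base +ᴹ t *ₗ direction ∈ mem C
  Line-between C convex L {a} {t} {b} a∈C b∈C a≤t t≤b with em {P = b - a ≈ 0#}
  ... | yes b-a≈0 = resp C (+ᴹ-congˡ (*ₗ-congʳ (O.antisym a≤t t≤a))) a∈C
    where
    t≤a : t ≤ a
    t≤a = O.≤-respʳ-≈ (trans (x-y≈z⇒x≈y+z b-a≈0) (+-identityʳ a)) t≤b
  ... | no b-a≉0 with e , inv ← inverse (b - a) b-a≉0 =
    resp C combination (convex a∈C b∈C
      (*-nonNeg (x≤y⇒0≤y-x t≤b) 0≤e) (*-nonNeg (x≤y⇒0≤y-x a≤t) 0≤e)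
      (trans (solve 4 (λ a b t e → (b :- t) :* e :+ (t :- a) :* e := (b :- a) :* e) refl a b t e) inv))
    where
    open Line L renaming (base to p; direction to u)
    open ≈ᴹ-Reasoning
    0≤e : 0# ≤ e
    0≤e = inverse-nonNeg (x≤y⇒0≤y-x (O.trans a≤t t≤b)) inv
    combination : ((b - t) * e) *ₗ (p +ᴹ a *ₗ u) +ᴹ ((t - a) * e) *ₗ (p +ᴹ b *ₗ u) ≈ᴹ p +ᴹ t *ₗ u
    combination = begin
      ((b - t) * e) *ₗ (p +ᴹ a *ₗ u) +ᴹ ((t - a) * e) *ₗ (p +ᴹ b *ₗ u)
        ≈⟨ solveᴹ (a ∷ b ∷ t ∷ e ∷ []) (p ∷ u ∷ [])
          (λ a b t e p u → ((b :- t) :* e) ⊙ (p ⊕ a ⊙ u) ⊕ ((t :- a) :* e) ⊙ (p ⊕ b ⊙ u) ⊜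
            ((b :- a) :* e) ⊙ (p ⊕ t ⊙ u)) ≡.refl ⟩
      ((b - a) * e) *ₗ (p +ᴹ t *ₗ u)   ≈⟨ *ₗ-congʳ inv ⟩
      1# *ₗ (p +ᴹ t *ₗ u)              ≈⟨ *ₗ-identityˡ _ ⟩
      p +ᴹ t *ₗ u                      ∎

  -- Traces preordered by the down-closures, with respect to ⊴, of their parameter sets on L.
  module _ (X : Subset) (L : Line) {_⊴_ : Rel Carrier ℓ} (⊴-refl : ∀ {s} → s ⊴ s)
           (⊴-trans : ∀ {r s t} → r ⊴ s → s ⊴ t → r ⊴ t) (⊴-total : ∀ s t → s ⊴ t ⊎ t ⊴ s) where

    open Line L

    Dominated : Rel (Trace X) ℓ
    Dominated (S , _) (T , _) = ∀ {s} → base +ᴹ s *ₗ direction ∈ mem S →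
                                ∃[ t ] (base +ᴹ t *ₗ direction ∈ mem T × s ⊴ t)

    -- Down-closed sets of a total order are nested: an element of `T` not dominated by `S` lies
    -- above all of `S`.
    Dominated-total : ∀ S T → Dominated S T ⊎ Dominated T S
    Dominated-total S T with em {P = Dominated S T}
    ... | yes S⊑T = inj₁ S⊑T
    ... | no S⋢T = inj₂ λ {t} t∈T → decidable-stable em λ ¬dominated →
      S⋢T λ {s} s∈S → t , t∈T ,
        [ id , (λ t⊴s → contradiction (s , s∈S , t⊴s) ¬dominated) ]′ (⊴-total s t)

    dominanceOrder : TotalOrder (Level.suc ℓ) ℓ ℓ
    dominanceOrder = record
      { Carrier = Trace X
      ; _≈_ = λ S T → Dominated S T × Dominated T S
      ; _≤_ = Dominated
      ; isTotalOrder = record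
        { isPartialOrder = record
          { isPreorder = record
            { isEquivalence = record
              { refl  = λ {S} → reflexivity {S} , reflexivity {S}
              ; sym   = λ { (S⊑T , T⊑S) → T⊑S , S⊑T }
              ; trans = λ { {S} {T} {U} (S⊑T , T⊑S) (T⊑U , U⊑T) →
                  transitivity {S} {T} {U} S⊑T T⊑U , transitivity {U} {T} {S} U⊑T T⊑S }
              }
            ; reflexive = proj₁
            ; trans     = λ {S} {T} {U} → transitivity {S} {T} {U}
            }
          ; antisym = _,_
          }
        ; total = Dominated-total
        }
      }
      where
      reflexivity : ∀ {S} → Dominated S S
      reflexivity s∈S = _ , s∈S , ⊴-refl
      transitivity : ∀ {S T U} → Dominated S T → Dominated T U → Dominated S U
      transitivity S⊑T T⊑U s∈S =
        let t , t∈T , s⊴t = S⊑T s∈S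
            u , u∈U , t⊴u = T⊑U t∈T
        in u , u∈U , ⊴-trans s⊴t t⊴u

  lines⇒finiteDimension : ∀ X → InFiniteUnionOfLines X → FiniteOrderDimension (Co X)
  lines⇒finiteDimension X (n , L , covers) =
    -- The 2n chains bound the dimension, and `least` picks the smallest number of chains that
    -- suffices.
    let d , embeds , minimal = least (n ℕ.+ n , chains , (λ S _ → S) , isMonomorphism)
    in d , record { embeds = embeds ; least = minimal }
    where
    side : Fin n ⊎ Fin n → Rel Carrier ℓ
    side (inj₁ _) = _≤_
    side (inj₂ _) = flip _≤_

    side-refl : ∀ k {s} → side k s s
    side-refl (inj₁ _) = O.refl
    side-refl (inj₂ _) = O.refl

    side-trans : ∀ k {r s t} → side k r s → side k s t → side k r t
    side-trans (inj₁ _) = O.trans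
    side-trans (inj₂ _) = flip O.trans

    side-total : ∀ k s t → side k s t ⊎ side k t s
    side-total (inj₁ _) = O.total
    side-total (inj₂ _) = flip O.total

    chain : Fin n ⊎ Fin n → TotalOrder (Level.suc ℓ) ℓ ℓ
    chain k = dominanceOrder X (L ([ id , id ]′ k)) (side-refl k) (side-trans k) (side-total k)

    chains : Fin (n ℕ.+ n) → TotalOrder (Level.suc ℓ) ℓ ℓ
    chains k = chain (Fin.splitAt n k)

    module P = Poset (Co X)
    module Q = Poset (∏ chains)

    monotone : ∀ {S T} → S P.≤ T → (λ _ → S) Q.≤ (λ _ → T)
    monotone S⊆T k {s} s∈S = s , S⊆T s∈S , side-refl (Fin.splitAt n k)

    -- On a line through `x`, the two chains supply points of `T` on either side of `x`. The convex
    -- set `D` cutting out `T` therefore contains `x`, and `x` is in `X`.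
    cancel : ∀ {S T} → (λ _ → S) Q.≤ (λ _ → T) → S P.≤ T
    cancel {S′@(S , _ , _ , S⊆C∩X , _)} {T′@(T , D , D-convex , T⊆D∩X , D∩X⊆T)} S⊑T {x} x∈S =
      let x∈X = proj₂ (S⊆C∩X x∈S)
          i , s , x≈ = covers x∈X
          s∈S = resp S x≈ x∈S
          b , b∈T , s≤b = ≡.subst (λ k → TotalOrder._≤_ (chain k) S′ T′) (Fin.splitAt-↑ˡ n i n)
                            (S⊑T (i Fin.↑ˡ n)) s∈S
          a , a∈T , a≤s = ≡.subst (λ k → TotalOrder._≤_ (chain k) S′ T′) (Fin.splitAt-↑ʳ n n i)
                            (S⊑T (n Fin.↑ʳ i)) s∈S
      in D∩X⊆T (resp D (≈ᴹ-sym x≈) (Line-between D D-convex (L i)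
           (proj₁ (T⊆D∩X a∈T)) (proj₁ (T⊆D∩X b∈T)) a≤s s≤b) , x∈X)

    isMonomorphism : IsOrderMonomorphism P._≈_ Q._≈_ P._≤_ Q._≤_ (λ S _ → S)
    isMonomorphism = record
      { isOrderHomomorphism = record
        { cong = λ { {S} {T} (S⊆T , T⊆S) k → monotone {S} {T} S⊆T k , monotone {T} {S} T⊆S k }
        ; mono = λ {S} {T} → monotone {S} {T}
        }
      ; injective = λ {S} {T} S≈T →
          cancel {S} {T} (λ k → proj₁ (S≈T k)) , cancel {T} {S} (λ k → proj₂ (S≈T k))
      ; cancel = λ {S} {T} → cancel {S} {T}
      }

  -- Standard examples from convexly independent sets

  trace : ∀ X C → Convex C → Trace X
  trace X C convex = record
    { mem  = mem C ∩ mem X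
    ; resp = λ { x≈y (x∈C , x∈X) → resp C x≈y x∈C , resp X x≈y x∈X }
    } , C , convex , id , id

  singleton : Carrierᴹ → Subset
  singleton y = record { mem = _≈ᴹ y ; resp = λ x≈z x≈y → ≈ᴹ-trans (≈ᴹ-sym x≈z) x≈y }

  singleton-convex : ∀ y → Convex (singleton y)
  singleton-convex y {s = s} {t} x≈y z≈y _ _ s+t≈1 =
    ≈ᴹ-trans (+ᴹ-cong (*ₗ-congˡ x≈y) (*ₗ-congˡ z≈y))
      (≈ᴹ-trans (≈ᴹ-sym (*ₗ-distribʳ y s t)) (≈ᴹ-trans (*ₗ-congʳ s+t≈1) (*ₗ-identityˡ y)))

  infinite⇒distinctSequence : ∀ Y → Infinite Y →
    Σ[ y ∈ (ℕ → Carrierᴹ) ] ((∀ n → y n ∈ mem Y) × (∀ {i j} → i <ₙ j → ¬ y j ≈ᴹ y i))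
  infinite⇒distinctSequence Y Y∞ = sequence , (λ n → proj₁ (sequence-extends n)) ,
    λ i<j yj≈yi → proj₂ (sequence-extends _) (lose (sequence∈history i<j) yj≈yi)
    where
    extend : ∀ l → ∃[ y ] (y ∈ mem Y × ¬ Any (y ≈ᴹ_) l)
    extend l = decidable-stable em λ none →
      Y∞ (l , λ y∈Y → decidable-stable em λ y∉l → none (_ , y∈Y , y∉l))
    open GreedySequence extend

  module _ {a ℓ₁ ℓ₂ n} (C : Fin n → TotalOrder a ℓ₁ ℓ₂) where

    private module C i = TotalOrder (C i)

    -- Among `suc n` indices, two, `j` and `k`, are separated in the same chain. There `p j ≤ q k`
    -- and `p k ≤ q j`, so whichever of `q j` and `q k` is larger contradicts one of the
    -- separations.
    noStandardExample : (p q : ℕ → ∀ i → C.Carrier i) → (∀ j → ∃[ i ] ¬ C._≤_ i (p j i) (q j i)) →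
                        ¬ (∀ {j k} → j ≢ k → ∀ i → C._≤_ i (p j i) (q k i))
    noStandardExample p q separable p≤q =
      let a , b , a<b , same = Fin.pigeonhole (ℕ.n<1+n n) (λ a → proj₁ (separable (toℕ a)))
          j = toℕ a
          k = toℕ b
          i , pj≰qj = separable j
          pk≰qk = ≡.subst (λ i → ¬ C._≤_ i (p k i) (q k i)) (≡.sym same) (proj₂ (separable k))
      in [ (λ qk≤qj → pj≰qj (C.trans i (p≤q (ℕ.<⇒≢ a<b) i) qk≤qj))
         , (λ qj≤qk → pk≰qk (C.trans i (p≤q (ℕ.<⇒≢ a<b ∘ ≡.sym) i) qj≤qk)) ]′
         (C.total i (q k i) (q j i))

  -- The traces {yⱼ} and conv (Y ∖ yⱼ) ∩ X form a standard example: yₖ lies in the latter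
  -- iff k ≠ j, so that each chain can witness yⱼ ∉ conv (Y ∖ yⱼ) for at most one j.
  finiteDimension⇒noInfiniteIndependent : ∀ X → FiniteOrderDimension (Co X) →
                                          ¬ HasInfiniteConvexlyIndependentSubset X
  finiteDimension⇒noInfiniteIndependent X (n , dimension) (Y , Y⊆X , Y∞ , Y-independent)
    with C , f , f-mono ← IsOrderDimension.embeds dimension
       | y , y∈Y , distinct ← infinite⇒distinctSequence Y Y∞ =
    noStandardExample C (λ j → f (point j)) (λ j → f (rest j)) separable point≤rest
    where
    module C i = TotalOrder (C i)
    open IsOrderMonomorphism f-mono using (mono; cancel)

    point rest : ℕ → Trace X
    point j = trace X (singleton (y j)) (singleton-convex (y j))
    rest  j = trace X (convexHull (mem Y ∖ y j)) (convexHull-convex (mem Y ∖ y j))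

    separable : ∀ j → ∃[ i ] ¬ C._≤_ i (f (point j) i) (f (rest j) i)
    separable j = decidable-stable em λ none → Y-independent (y∈Y j) (proj₁
      (cancel {point j} {rest j} (λ i → decidable-stable em (λ ≰ → none (i , ≰)))
        (≈ᴹ-refl , Y⊆X (y∈Y j))))

    y-injective : ∀ {j k} → j ≢ k → ¬ y j ≈ᴹ y k
    y-injective {j} {k} j≢k yj≈yk with ℕ.<-cmp j k
    ... | tri< j<k _ _ = distinct j<k (≈ᴹ-sym yj≈yk)
    ... | tri≈ _ j≡k _ = j≢k j≡k
    ... | tri> _ _ k<j = distinct k<j yj≈yk

    point≤rest : ∀ {j k} → j ≢ k → ∀ i → C._≤_ i (f (point j) i) (f (rest k) i)
    point≤rest {j} {k} j≢k = mono {point j} {rest k} λ { (x≈yj , x∈X) →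
      resp (convexHull (mem Y ∖ y k)) (≈ᴹ-sym x≈yj)
        (∈-conv (mem Y ∖ y k) (y∈Y j , y-injective j≢k)) , x∈X }

theorem5p2 : (∀ {a} → ExcludedMiddle a) →
    ∀ {ℓ} (ℝ : RealField ℓ) (V : RealVectorSpace ℝ) →
    let open Convexity ℝ V in
    Nontrivial → (X : Subset) →
    (InFiniteUnionOfLines X ⇔ (¬ HasInfiniteConvexlyIndependentSubset X)) ×
    ((¬ HasInfiniteConvexlyIndependentSubset X) ⇔ FiniteOrderDimension (Co X))
theorem5p2 em ℝ V nontrivial X =
  -- Three implications form the cycle (i) ⇒ (iii) ⇒ (ii) ⇒ (i), and both equivalences are read off
  -- from it.
  mk⇔ (finiteDimension⇒noInfiniteIndependent X ∘ lines⇒finiteDimension X)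
      (noInfiniteIndependent⇒lines nontrivial X) ,
  mk⇔ (lines⇒finiteDimension X ∘ noInfiniteIndependent⇒lines nontrivial X)
      (finiteDimension⇒noInfiniteIndependent X)
  where open ConvexPosition em ℝ V
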